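{- Let $K$ be a function field in one variable of characteristic $p>0$ over a field $F$ algebraically closed in $K$. Let $t\in K\setminus F$ be an element which is not a $p$-th power in $K$ and which has at least one simple zero or simple pole (i.e. some prime $\mathfrak{q}$ of $K$ with $\mathrm{ord}_{\mathfrak q}t=\pm1$). Suppose that $p(K,t)=\{x\in K:\exists s\in\mathbb{Z}_{>0},\ x=t^{p^s}\}$ is definable in $K$. Then the structure $\langle \mathbb{Z}_{>0},+,\mid\rangle$ has a model in $K$; specifically, under the bijection $s\mapsto t^{p^s}$ from $\mathbb{Z}_{>0}$ onto $p(K,t)$, the graphs of addition and of divisibility correspond to definable subsets of $K^3$ and $K^2$ respectively.
   Context: "Definable in $K$" means first-order definable in the language of rings with finitely many parameters from $K$. A model of $\langle\mathbb{Z}_{>0},+,\mid\rangle$ in $K$ is a bijection $\phi$ from $\mathbb{Z}_{>0}$ onto a definable subset $D\subseteq K^d$ (some $d\ge1$) such that the images under $\phi$ of the graph of $+$ and of the divisibility relation $\mid$ are definable subsets of $D^3$ and $D^2$ respectively. -}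

module Defs where

open import Level using (Level; _⊔_; suc; Lift)
open import Algebra.Bundles using (CommutativeRing; Semiring)
import Algebra.Definitions.RawSemiring as RawSemiringDefinitions
open import Data.Empty using (⊥)
open import Data.Fin.Base using (Fin)
open import Data.Integer.Base as ℤ using (ℤ; 0ℤ; 1ℤ; -1ℤ)
open import Data.List.Base as List using (List)
open import Data.List.Relation.Unary.All using (All)
open import Data.List.Relation.Unary.Any using (Any)
open import Data.Nat.Base as ℕ using (ℕ; NonZero)
open import Data.Nat.Divisibility using (_∣_)
open import Data.Product.Base using (Σ; Σ-syntax; ∃-syntax; _×_; _,_; proj₁)
open import Data.Sum.Base using (_⊎_)
open import Data.Vec.Base using (Vec; []; _∷_; _++_; head; lookup)
open import Data.Vec.Functional using (Vector)
open import Data.Vec.Relation.Binary.Pointwise.Inductive using (Pointwise)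
open import Function.Bundles using (_⇔_)
open import Function.Definitions using (Injective)
open import Relation.Binary.PropositionalEquality.Core using (_≡_)
open import Relation.Nullary.Negation.Core using (¬_)
open import Relation.Unary using (Pred)

------------------------------------------------------------------------
-- First-order formulas in the language of rings (de Bruijn indices;
-- negation is φ ⇒ ⊥′)

infixl 6 _+′_
infixl 7 _*′_
infix  8 -′_
infix  4 _≐_
infixr 3 _∧_
infixr 2 _∨_
infixr 1 _⇒_

data Term (n : ℕ) : Set where
  var       : Fin n → Term n
  0′ 1′     : Term n
  _+′_ _*′_ : Term n → Term n → Term n
  -′_       : Term n → Term n

data Formula (n : ℕ) : Set where
  _≐_         : Term n → Term n → Formula n
  ⊥′          : Formula n
  _∧_ _∨_ _⇒_ : Formula n → Formula n → Formula n
  ∀′ ∃′       : Formula (ℕ.suc n) → Formula n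

ℤ>0 : Set
ℤ>0 = Σ ℕ NonZero

module _ {c ℓ} (K : CommutativeRing c ℓ) where

  open CommutativeRing K
  open RawSemiringDefinitions (Semiring.rawSemiring semiring) using (_^_; sum) renaming (_×_ to _·_)

  private
    variable
      f : Level

  _≋_ : ∀ {n} → Vec Carrier n → Vec Carrier n → Set (c ⊔ ℓ)
  _≋_ = Pointwise _≈_

  ----------------------------------------------------------------------
  -- Definability

  ⟦_⟧ : ∀ {n} → Term n → Vec Carrier n → Carrier
  ⟦ var i ⟧ ρ = lookup ρ i
  ⟦ 0′ ⟧ ρ = 0#
  ⟦ 1′ ⟧ ρ = 1#
  ⟦ s +′ t ⟧ ρ = ⟦ s ⟧ ρ + ⟦ t ⟧ ρ
  ⟦ s *′ t ⟧ ρ = ⟦ s ⟧ ρ * ⟦ t ⟧ ρ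
  ⟦ -′ t ⟧ ρ = - ⟦ t ⟧ ρ

  Sat : ∀ {n} → Formula n → Vec Carrier n → Set (c ⊔ ℓ)
  Sat (s ≐ t) ρ = Lift c (⟦ s ⟧ ρ ≈ ⟦ t ⟧ ρ)
  Sat ⊥′ ρ = Lift (c ⊔ ℓ) ⊥
  Sat (φ ∧ ψ) ρ = Sat φ ρ × Sat ψ ρ
  Sat (φ ∨ ψ) ρ = Sat φ ρ ⊎ Sat ψ ρ
  Sat (φ ⇒ ψ) ρ = Sat φ ρ → Sat ψ ρ
  Sat (∀′ φ) ρ = (x : Carrier) → Sat φ (x ∷ ρ)
  Sat (∃′ φ) ρ = ∃[ x ] Sat φ (x ∷ ρ)

  Definable : ∀ {n s} → Pred (Vec Carrier n) s → Set (c ⊔ ℓ ⊔ s)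
  Definable {n} S =
    ∃[ m ] Σ[ params ∈ Vec Carrier m ] Σ[ φ ∈ Formula (n ℕ.+ m) ]
      (∀ v → S v ⇔ Sat φ (v ++ params))

  ----------------------------------------------------------------------
  -- Models of ⟨ℤ>0, +, ∣⟩ in K

  -- (Kᵈ)³ and (Kᵈ)² are identified with K³ᵈ and K²ᵈ by concatenation.

  AdditionGraph : ∀ {d} → (ℤ>0 → Vec Carrier d) →
                  Pred (Vec Carrier (d ℕ.+ (d ℕ.+ d))) (c ⊔ ℓ)
  AdditionGraph φ v = ∃[ k ] ∃[ m ] ∃[ n ]
    (proj₁ k ℕ.+ proj₁ m ≡ proj₁ n) × (v ≋ (φ k ++ (φ m ++ φ n)))

  DivisibilityGraph : ∀ {d} → (ℤ>0 → Vec Carrier d) →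
                      Pred (Vec Carrier (d ℕ.+ d)) (c ⊔ ℓ)
  DivisibilityGraph φ v = ∃[ m ] ∃[ n ]
    (proj₁ m ∣ proj₁ n) × (v ≋ (φ m ++ φ n))

  record IsModel {d s} (D : Pred (Vec Carrier d) s)
                 (φ : ℤ>0 → Vec Carrier d) : Set (c ⊔ ℓ ⊔ s) where
    field
      D-definable  : Definable D
      into         : ∀ n → D (φ n)
      injective    : Injective _≡_ _≋_ φ
      onto         : ∀ {v} → D v → ∃[ n ] (v ≋ φ n)
      +-definable  : Definable (AdditionGraph φ)
      ∣-definable  : Definable (DivisibilityGraph φ)

  HasModel : Set (suc (c ⊔ ℓ))
  HasModel = ∃[ d ] NonZero d ×
    Σ[ D ∈ Pred (Vec Carrier d) (c ⊔ ℓ) ] ∃[ φ ] IsModel D φ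

  ----------------------------------------------------------------------
  -- Fields and function fields

  record IsField : Set (c ⊔ ℓ) where
    field
      1≉0     : 1# ≉ 0#
      inverse : ∀ x → x ≉ 0# → ∃[ y ] (x * y ≈ 1#)

  HasCharacteristic : ℕ → Set ℓ
  HasCharacteristic p = ∀ n → (n · 1# ≈ 0#) ⇔ (p ∣ n)

  record IsSubfield (F : Pred Carrier f) : Set (c ⊔ ℓ ⊔ f) where
    field
      resp      : ∀ {x y} → x ≈ y → F x → F y
      0-closed  : F 0#
      1-closed  : F 1#
      +-closed  : ∀ {x y} → F x → F y → F (x + y)
      *-closed  : ∀ {x y} → F x → F y → F (x * y)
      neg-closed : ∀ {x} → F x → F (- x)
      inv-closed : ∀ {x y} → F x → x * y ≈ 1# → F y

  -- Polynomials are coefficient lists, constant term first.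
  evalPoly : List Carrier → Carrier → Carrier
  evalPoly as x = List.foldr (λ a r → a + x * r) 0# as

  Algebraic : Pred Carrier f → Carrier → Set (c ⊔ ℓ ⊔ f)
  Algebraic F x = ∃[ as ] All F as × Any (_≉ 0#) as × (evalPoly as x ≈ 0#)

  Transcendental : Pred Carrier f → Carrier → Set (c ⊔ ℓ ⊔ f)
  Transcendental F x = ¬ Algebraic F x

  AlgebraicallyClosedIn : Pred Carrier f → Set (c ⊔ ℓ ⊔ f)
  AlgebraicallyClosedIn F = ∀ x → Algebraic F x → F x

  -- The subfield F(z) generated by F and z.
  data Adjoin (F : Pred Carrier f) (z : Carrier) : Pred Carrier (c ⊔ ℓ ⊔ f) where
    base : ∀ {x} → F x → Adjoin F z x
    gen  : Adjoin F z z
    resp : ∀ {x y} → x ≈ y → Adjoin F z x → Adjoin F z y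
    add  : ∀ {x y} → Adjoin F z x → Adjoin F z y → Adjoin F z (x + y)
    mul  : ∀ {x y} → Adjoin F z x → Adjoin F z y → Adjoin F z (x * y)
    neg  : ∀ {x} → Adjoin F z x → Adjoin F z (- x)
    inv  : ∀ {x y} → Adjoin F z x → x * y ≈ 1# → Adjoin F z y

  FiniteOver : Pred Carrier f → Set (c ⊔ ℓ ⊔ f)
  FiniteOver E = ∃[ n ] Σ[ b ∈ Vector Carrier n ] (∀ x →
    Σ[ e ∈ Vector Carrier n ] (∀ i → E (e i)) × (x ≈ sum (λ i → e i * b i)))

  record IsFunctionField (F : Pred Carrier f) : Set (c ⊔ ℓ ⊔ f) where
    field
      isField        : IsField
      isSubfield     : IsSubfield F
      z              : Carrier
      transcendental : Transcendental F z
      finite         : FiniteOver (Adjoin F z)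

  -- A prime of the function field K/F, given by its normalised discrete
  -- valuation, which is trivial on the constants.  ord is only applied to
  -- elements with a proof that they are nonzero (ord 0 would be ∞), so that
  -- its existence does not presuppose that equality on K is decidable.
  record Prime (F : Pred Carrier f) : Set (c ⊔ ℓ ⊔ f) where
    field
      ord        : (x : Carrier) → x ≉ 0# → ℤ
      ord-cong   : ∀ {x y} (x≉0 : x ≉ 0#) (y≉0 : y ≉ 0#) → x ≈ y →
                   ord x x≉0 ≡ ord y y≉0
      ord-*      : ∀ {x y} (x≉0 : x ≉ 0#) (y≉0 : y ≉ 0#) (xy≉0 : x * y ≉ 0#) →
                   ord (x * y) xy≉0 ≡ ord x x≉0 ℤ.+ ord y y≉0
      ord-+      : ∀ {x y} (x≉0 : x ≉ 0#) (y≉0 : y ≉ 0#) (x+y≉0 : x + y ≉ 0#) →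
                   ord x x≉0 ℤ.⊓ ord y y≉0 ℤ.≤ ord (x + y) x+y≉0
      normalised : Σ[ x ∈ Carrier ] Σ[ x≉0 ∈ x ≉ 0# ] (ord x x≉0 ≡ 1ℤ)
      constant   : ∀ {x} (x≉0 : x ≉ 0#) → F x → ord x x≉0 ≡ 0ℤ

  HasSimpleZeroOrPole : Pred Carrier f → Carrier → Set (c ⊔ ℓ ⊔ f)
  HasSimpleZeroOrPole F t = Σ[ 𝔮 ∈ Prime F ] Σ[ t≉0 ∈ t ≉ 0# ]
    (Prime.ord 𝔮 t t≉0 ≡ 1ℤ ⊎ Prime.ord 𝔮 t t≉0 ≡ -1ℤ)

  IsPower : ℕ → Carrier → Set (c ⊔ ℓ)
  IsPower n x = ∃[ y ] (x ≈ y ^ n)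

  frobeniusPower : ℕ → Carrier → ℤ>0 → Vec Carrier 1
  frobeniusPower p t (s , _) = t ^ (p ℕ.^ s) ∷ []

  -- The set p(K,t), as a subset of K¹.
  pPowers : ℕ → Carrier → Pred (Vec Carrier 1) ℓ
  pPowers p t v = Σ[ s ∈ ℤ>0 ] (head v ≈ t ^ (p ℕ.^ proj₁ s))

{-# OPTIONS --safe #-}
module Submission where

open import Defs
open import Algebra.Bundles using (AbelianGroup; CommutativeRing; Semiring)
import Algebra.Definitions.RawSemiring as RawSemiringDefinitions
import Algebra.Properties.CommutativeSemiring.Binomial as Binomial
import Algebra.Properties.CommutativeSemiring.Exp as CSExp
import Algebra.Properties.Group as GroupProperties
import Algebra.Properties.Ring as RingProperties
import Algebra.Properties.Semiring.Exp as SExp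
import Algebra.Properties.Semiring.Mult as Mult
import Algebra.Properties.Semiring.Sum as SumProperties
import Algebra.Solver.Ring.NaturalCoefficients.Default as RingSolver
open import Data.Fin.Base using (Fin; zero; suc; toℕ; inject₁; fromℕ; splitAt; _↑ˡ_; _↑ʳ_)
open import Data.Fin.Properties using (toℕ<n; toℕ-inject₁; toℕ-fromℕ)
open import Data.Integer.Base as ℤ using (+_; 0ℤ; 1ℤ; -1ℤ; +<+)
import Data.Integer.Properties as ℤ
open import Data.Integer.Solver using (module +-*-Solver)
open import Data.Nat.Base as ℕ using (ℕ; _<_; _≤_)
open import Data.Nat.Combinatorics using (nCn≡1)
open import Data.Nat.Divisibility using (_∣_; _∤_; _∣?_; divides; ∣-refl; hasNonTrivialDivisor; ∣⇒≤; ∣1⇒≡1; m∣m*n)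
import Data.Nat.Primality as Primality
open Primality using () renaming (Prime to PrimeNumber)
import Data.Nat.Properties as ℕ
open import Data.Product.Base as Product using (Σ-syntax; ∃-syntax; _×_; _,_; proj₁; proj₂)
open import Data.Sum.Base as Sum using (_⊎_; inj₁; inj₂; [_,_]′)
open import Data.Vec.Base as Vec using (Vec; []; _∷_; _++_; lookup)
open import Data.Vec.Properties using (lookup-++ˡ; lookup-++ʳ; lookup-map; lookup-splitAt)
open import Data.Vec.Relation.Binary.Pointwise.Inductive using ([]; _∷_)
open import Function.Base using (_∘_)
open import Function.Bundles using (_⇔_; mk⇔; module Equivalence)
import Function.Properties.Equivalence as ⇔
open import Level using (Level; Lift; lift; lower; _⊔_)
open import Relation.Binary.Definitions using (tri<; tri≈; tri>)
import Relation.Binary.PropositionalEquality as ≡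
open ≡ using (_≡_; _≢_)
import Relation.Binary.Reasoning.Setoid as SetoidReasoning
open import Relation.Nullary.Decidable.Core using (decidable-stable)
open import Relation.Nullary.Negation.Core using (¬_; contradiction)
open import Relation.Unary using (Pred)

open Equivalence using (to; from)

-- Replacing t by t⁻¹ if necessary, there is τ with a simple pole at 𝔮.  Write a ∼ b for equality
-- modulo the image of the Artin–Schreier map g ↦ gᵖ − g; then xᵖ ∼ x, whereas an element whose order
-- at 𝔮 is negative and prime to p is not ∼ 0.  Hence for x, y, z = τ^(pᵏ), τ^(pᵐ), τ^(pⁿ) the relation
-- z y ∼ x τ holds iff n = k + m or m = k + n, and the second alternative is excluded by zᵖ y ∼ xᵖ τ.
-- This defines addition, and with it the iterated Frobenius maps: v = w^(pᵐ) iff there are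
-- g₀ = v, g₁, …, gₘ = w with gⱼ = gⱼ₊₁ᵖ, and each gⱼ is pinned down without the sequence by
-- v c^(pʲ) ∼ gⱼ c for the multipliers c = τ^(pⁱ) and τ^(pⁱ + 1), i > 0.
-- Finally m ∣ n iff pᵐ − 1 ∣ pⁿ − 1 iff w^(pᵐ − 1) = τ^(pⁿ − 1) for some w ∈ K.

-- Renaming of variables in terms and formulas.

renameTerm : ∀ {m n} → (Fin m → Fin n) → Term m → Term n
renameTerm σ (var i)  = var (σ i)
renameTerm σ 0′       = 0′
renameTerm σ 1′       = 1′
renameTerm σ (s +′ t) = renameTerm σ s +′ renameTerm σ t
renameTerm σ (s *′ t) = renameTerm σ s *′ renameTerm σ t
renameTerm σ (-′ t)   = -′ renameTerm σ t

liftRenaming : ∀ {m n} → (Fin m → Fin n) → Fin (ℕ.suc m) → Fin (ℕ.suc n)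
liftRenaming σ zero    = zero
liftRenaming σ (suc i) = suc (σ i)

renameFormula : ∀ {m n} → (Fin m → Fin n) → Formula m → Formula n
renameFormula σ (s ≐ t) = renameTerm σ s ≐ renameTerm σ t
renameFormula σ ⊥′      = ⊥′
renameFormula σ (φ ∧ ψ) = renameFormula σ φ ∧ renameFormula σ ψ
renameFormula σ (φ ∨ ψ) = renameFormula σ φ ∨ renameFormula σ ψ
renameFormula σ (φ ⇒ ψ) = renameFormula σ φ ⇒ renameFormula σ ψ
renameFormula σ (∀′ φ)  = ∀′ (renameFormula (liftRenaming σ) φ)
renameFormula σ (∃′ φ)  = ∃′ (renameFormula (liftRenaming σ) φ)

module Renaming {c ℓ} (K : CommutativeRing c ℓ) where
  open CommutativeRing K using (Carrier; _+_; _*_; -_)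

  ⟦renameTerm⟧ : ∀ {m n} (σ : Fin m → Fin n) (ρ : Vec Carrier n) (ρ′ : Vec Carrier m) →
    (∀ i → lookup ρ (σ i) ≡ lookup ρ′ i) → ∀ t → ⟦_⟧ K (renameTerm σ t) ρ ≡ ⟦_⟧ K t ρ′
  ⟦renameTerm⟧ σ ρ ρ′ eq (var i)  = eq i
  ⟦renameTerm⟧ σ ρ ρ′ eq 0′       = ≡.refl
  ⟦renameTerm⟧ σ ρ ρ′ eq 1′       = ≡.refl
  ⟦renameTerm⟧ σ ρ ρ′ eq (s +′ t) = ≡.cong₂ _+_ (⟦renameTerm⟧ σ ρ ρ′ eq s) (⟦renameTerm⟧ σ ρ ρ′ eq t)
  ⟦renameTerm⟧ σ ρ ρ′ eq (s *′ t) = ≡.cong₂ _*_ (⟦renameTerm⟧ σ ρ ρ′ eq s) (⟦renameTerm⟧ σ ρ ρ′ eq t)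
  ⟦renameTerm⟧ σ ρ ρ′ eq (-′ t)   = ≡.cong -_ (⟦renameTerm⟧ σ ρ ρ′ eq t)

  lookup-liftRenaming : ∀ {m n} (σ : Fin m → Fin n) (ρ : Vec Carrier n) (ρ′ : Vec Carrier m) →
    (∀ i → lookup ρ (σ i) ≡ lookup ρ′ i) →
    ∀ x i → lookup (x ∷ ρ) (liftRenaming σ i) ≡ lookup (x ∷ ρ′) i
  lookup-liftRenaming σ ρ ρ′ eq x zero    = ≡.refl
  lookup-liftRenaming σ ρ ρ′ eq x (suc i) = eq i

  Sat-rename : ∀ {m n} (σ : Fin m → Fin n) (ρ : Vec Carrier n) (ρ′ : Vec Carrier m) →
    (∀ i → lookup ρ (σ i) ≡ lookup ρ′ i) → ∀ φ → Sat K φ ρ′ ⇔ Sat K (renameFormula σ φ) ρ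
  Sat-rename σ ρ ρ′ eq (s ≐ t)
    rewrite ⟦renameTerm⟧ σ ρ ρ′ eq s | ⟦renameTerm⟧ σ ρ ρ′ eq t = ⇔.refl
  Sat-rename σ ρ ρ′ eq ⊥′      = ⇔.refl
  Sat-rename σ ρ ρ′ eq (φ ∧ ψ) = mk⇔ (Product.map (to φ⇔) (to ψ⇔)) (Product.map (from φ⇔) (from ψ⇔))
    where φ⇔ = Sat-rename σ ρ ρ′ eq φ ; ψ⇔ = Sat-rename σ ρ ρ′ eq ψ
  Sat-rename σ ρ ρ′ eq (φ ∨ ψ) = mk⇔ (Sum.map (to φ⇔) (to ψ⇔)) (Sum.map (from φ⇔) (from ψ⇔))
    where φ⇔ = Sat-rename σ ρ ρ′ eq φ ; ψ⇔ = Sat-rename σ ρ ρ′ eq ψ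
  Sat-rename σ ρ ρ′ eq (φ ⇒ ψ) = mk⇔ (λ h → to ψ⇔ ∘ h ∘ from φ⇔) (λ h → from ψ⇔ ∘ h ∘ to φ⇔)
    where φ⇔ = Sat-rename σ ρ ρ′ eq φ ; ψ⇔ = Sat-rename σ ρ ρ′ eq ψ
  Sat-rename σ ρ ρ′ eq (∀′ φ)  = mk⇔ (λ h x → to (φ⇔ x) (h x)) (λ h x → from (φ⇔ x) (h x))
    where φ⇔ = λ x → Sat-rename (liftRenaming σ) (x ∷ ρ) (x ∷ ρ′) (lookup-liftRenaming σ ρ ρ′ eq x) φ
  Sat-rename σ ρ ρ′ eq (∃′ φ)  = mk⇔ (λ (x , h) → x , to (φ⇔ x) h) (λ (x , h) → x , from (φ⇔ x) h)
    where φ⇔ = λ x → Sat-rename (liftRenaming σ) (x ∷ ρ) (x ∷ ρ′) (lookup-liftRenaming σ ρ ρ′ eq x) φ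

-- Definable sets over a fixed list of parameters.

module DefinableOver {c ℓ} (K : CommutativeRing c ℓ) {M} (params : Vec (CommutativeRing.Carrier K) M) where
  open CommutativeRing K using (Carrier; _≈_; _+_; _*_; -_; 0#; 1#; semiring)
  open RawSemiringDefinitions (Semiring.rawSemiring semiring) using (_^_)
  open Renaming K

  private
    variable
      n k : ℕ
      a b : Level

  record TermDef (f : Vec Carrier n → Carrier) : Set c where
    constructor mkTermDef
    field
      term : Term (n ℕ.+ M)
      eval : ∀ v → ⟦_⟧ K term (v ++ params) ≡ f v

  -- All formulas share the parameters of the module, so they combine without merging parameter
  -- lists.
  record Def (S : Pred (Vec Carrier n) a) : Set (c ⊔ ℓ ⊔ a) where
    constructor mkDef
    field
      formula : Formula (n ℕ.+ M)
      correct : ∀ v → S v ⇔ Sat K formula (v ++ params)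

  Def⇒Definable : {S : Pred (Vec Carrier n) a} → Def S → Definable K S
  Def⇒Definable (mkDef φ φ⇔) = M , params , φ , φ⇔

  varᵗ : (i : Fin n) → TermDef (λ v → lookup v i)
  varᵗ i = mkTermDef (var (i ↑ˡ M)) (λ v → lookup-++ˡ v params i)

  paramᵗ : (i : Fin M) → TermDef {n} (λ _ → lookup params i)
  paramᵗ {n} i = mkTermDef (var (n ↑ʳ i)) (λ v → lookup-++ʳ v params i)

  weakenᵗ : {f : Vec Carrier n → Carrier} → TermDef f → TermDef (λ v → f (Vec.tail v))
  weakenᵗ (mkTermDef t t≡) = mkTermDef (renameTerm suc t) λ where
    (x ∷ v) → ≡.trans (⟦renameTerm⟧ suc (x ∷ (v ++ params)) (v ++ params) (λ _ → ≡.refl) t) (t≡ v)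

  1ᵗ : TermDef {n} (λ _ → 1#)
  1ᵗ = mkTermDef 1′ (λ _ → ≡.refl)

  0ᵗ : TermDef {n} (λ _ → 0#)
  0ᵗ = mkTermDef 0′ (λ _ → ≡.refl)

  infixl 6 _+ᵗ_
  infixl 7 _*ᵗ_
  infixr 8 _^ᵗ_

  _+ᵗ_ : {f g : Vec Carrier n → Carrier} → TermDef f → TermDef g → TermDef (λ v → f v + g v)
  mkTermDef s s≡ +ᵗ mkTermDef t t≡ = mkTermDef (s +′ t) (λ v → ≡.cong₂ _+_ (s≡ v) (t≡ v))

  _*ᵗ_ : {f g : Vec Carrier n → Carrier} → TermDef f → TermDef g → TermDef (λ v → f v * g v)
  mkTermDef s s≡ *ᵗ mkTermDef t t≡ = mkTermDef (s *′ t) (λ v → ≡.cong₂ _*_ (s≡ v) (t≡ v))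

  _^ᵗ_ : {f : Vec Carrier n → Carrier} → TermDef f → ∀ e → TermDef (λ v → f v ^ e)
  s ^ᵗ ℕ.zero  = 1ᵗ
  s ^ᵗ ℕ.suc e = s *ᵗ (s ^ᵗ e)

  infix  4 _≐ᵈ_
  infixr 3 _∧ᵈ_
  infixr 1 _⇒ᵈ_

  _≐ᵈ_ : {f g : Vec Carrier n → Carrier} → TermDef f → TermDef g → Def (λ v → f v ≈ g v)
  mkTermDef s s≡ ≐ᵈ mkTermDef t t≡ = mkDef (s ≐ t)
    λ v → ≡.subst₂ (λ x y → (x ≈ y) ⇔ Lift c (⟦_⟧ K s (v ++ params) ≈ ⟦_⟧ K t (v ++ params)))
      (s≡ v) (t≡ v) (mk⇔ lift lower)

  ¬ᵈ_ : {S : Pred (Vec Carrier n) a} → Def S → Def (λ v → ¬ S v)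
  ¬ᵈ mkDef φ φ⇔ = mkDef (φ ⇒ ⊥′) λ v → mk⇔ (λ ¬S s → lift (¬S (from (φ⇔ v) s))) (λ ¬s S → lower (¬s (to (φ⇔ v) S)))

  _∧ᵈ_ : {S : Pred (Vec Carrier n) a} {T : Pred (Vec Carrier n) b} →
    Def S → Def T → Def (λ v → S v × T v)
  mkDef φ φ⇔ ∧ᵈ mkDef ψ ψ⇔ = mkDef (φ ∧ ψ)
    λ v → mk⇔ (Product.map (to (φ⇔ v)) (to (ψ⇔ v))) (Product.map (from (φ⇔ v)) (from (ψ⇔ v)))

  _⇒ᵈ_ : {S : Pred (Vec Carrier n) a} {T : Pred (Vec Carrier n) b} →
    Def S → Def T → Def (λ v → S v → T v)
  mkDef φ φ⇔ ⇒ᵈ mkDef ψ ψ⇔ = mkDef (φ ⇒ ψ)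
    λ v → mk⇔ (λ h → to (ψ⇔ v) ∘ h ∘ from (φ⇔ v)) (λ h → from (ψ⇔ v) ∘ h ∘ to (φ⇔ v))

  ∀ᵈ : {S : Pred (Vec Carrier (ℕ.suc n)) a} → Def S → Def (λ v → ∀ x → S (x ∷ v))
  ∀ᵈ (mkDef φ φ⇔) = mkDef (∀′ φ)
    λ v → mk⇔ (λ h x → to (φ⇔ (x ∷ v)) (h x)) (λ h x → from (φ⇔ (x ∷ v)) (h x))

  ∃ᵈ : {S : Pred (Vec Carrier (ℕ.suc n)) a} → Def S → Def (λ v → ∃[ x ] S (x ∷ v))
  ∃ᵈ (mkDef φ φ⇔) = mkDef (∃′ φ)
    λ v → mk⇔ (λ (x , h) → x , to (φ⇔ (x ∷ v)) h) (λ (x , h) → x , from (φ⇔ (x ∷ v)) h)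

  Def-resp : {S : Pred (Vec Carrier n) a} {T : Pred (Vec Carrier n) b} →
    (∀ v → S v ⇔ T v) → Def S → Def T
  Def-resp S⇔T (mkDef φ φ⇔) = mkDef φ λ v → ⇔.trans (⇔.sym (S⇔T v)) (φ⇔ v)

  Def-reindex : {S : Pred (Vec Carrier k) a} → Def S → (is : Vec (Fin n) k) →
    Def (λ v → S (Vec.map (lookup v) is))
  Def-reindex {k = k} {n = n} (mkDef φ φ⇔) is = mkDef (renameFormula σ φ) λ v →
    ⇔.trans (φ⇔ (Vec.map (lookup v) is))
      (Sat-rename σ (v ++ params) (Vec.map (lookup v) is ++ params) (lookup-σ v) φ)
    where
    -- The free variables go to the positions listed in `is`; the parameters keep their places
    -- behind them.
    σ : Fin (k ℕ.+ M) → Fin (n ℕ.+ M)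
    σ i = [ (λ j → lookup is j ↑ˡ M) , n ↑ʳ_ ]′ (splitAt k i)

    lookup-σ : ∀ v i → lookup (v ++ params) (σ i) ≡ lookup (Vec.map (lookup v) is ++ params) i
    lookup-σ v i rewrite lookup-splitAt k (Vec.map (lookup v) is) params i with splitAt k i
    ... | inj₁ j = ≡.trans (lookup-++ˡ v params (lookup is j)) (≡.sym (lookup-map j (lookup v) is))
    ... | inj₂ j = lookup-++ʳ v params j

-- Makes room for one extra parameter; with `x` taken to be `τ`, further formulas can mention `τ`
-- next to the parameters of the given definition.
Definable⇒Def : ∀ {c ℓ a} (K : CommutativeRing c ℓ) {n} {S : Pred (Vec (CommutativeRing.Carrier K) n) a} →
  ((_ , params , _) : Definable K S) → ∀ x → DefinableOver.Def K (x ∷ params) S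
Definable⇒Def K {n} (m , params , φ , φ⇔) x = DefinableOver.mkDef (renameFormula σ φ) λ v →
  ⇔.trans (φ⇔ v) (Renaming.Sat-rename K σ (v ++ x ∷ params) (v ++ params) (lookup-σ v) φ)
  where
  σ : Fin (n ℕ.+ m) → Fin (n ℕ.+ ℕ.suc m)
  σ i = [ _↑ˡ ℕ.suc m , (λ j → n ↑ʳ suc j) ]′ (splitAt n i)

  lookup-σ : ∀ v i → lookup (v ++ x ∷ params) (σ i) ≡ lookup (v ++ params) i
  lookup-σ v i rewrite lookup-splitAt n v params i with splitAt n i
  ... | inj₁ j = lookup-++ˡ v (x ∷ params) j
  ... | inj₂ j = lookup-++ʳ v (x ∷ params) (suc j)

-- Arithmetic of primes, binomial coefficients and numbers pⁿ - 1.

module _ where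
  open import Data.Nat.Base
  open import Data.Nat.Combinatorics using (_C_; k![n∸k]!∣n!)
  open import Data.Nat.Combinatorics.Specification using (nCk≡n!/k![n-k]!)
  open import Data.Nat.Divisibility
  open import Data.Nat.DivMod using (m/n*n≡m)
  open import Data.Nat.Induction using (<-rec)
  open import Data.Nat.Primality using (prime; euclidsLemma)
  open import Data.Nat.Properties
  import Data.Nat.Solver as ℕ-Solver
  open import Relation.Nullary.Decidable.Core using (yes; no)
  open import Relation.Binary.PropositionalEquality

  prime>1 : ∀ {p} → PrimeNumber p → 1 < p
  prime>1 {p} (prime _) = nonTrivial⇒n>1 p

  prime∤! : ∀ {p k} → PrimeNumber p → k < p → p ∤ k !
  prime∤! {k = zero}  p-prime k<p p∣1 = contradiction (∣1⇒≡1 p∣1) (>⇒≢ (prime>1 p-prime))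
  prime∤! {k = suc k} p-prime k<p p∣k! with euclidsLemma (suc k) (k !) p-prime p∣k!
  ... | inj₁ p∣1+k = contradiction (∣⇒≤ p∣1+k) (<⇒≱ k<p)
  ... | inj₂ p∣k!  = prime∤! p-prime (<-trans (n<1+n k) k<p) p∣k!

  -- p divides p! = (p C k) · k! (p - k)!, but neither of the two factorials on the right, whose
  -- arguments are below p.
  prime∣binomial : ∀ {p k} → PrimeNumber p → 0 < k → k < p → p ∣ p C k
  prime∣binomial {p} {k} p-prime 0<k k<p with euclidsLemma (p C k) (k ! * (p ∸ k) !) p-prime p∣product
    where
    instance _ = k !≢0 ; _ = (p ∸ k) !≢0 ; _ = m*n≢0 (k !) ((p ∸ k) !)
    C*k!*[p∸k]!≡p! : (p C k) * (k ! * (p ∸ k) !) ≡ p !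
    C*k!*[p∸k]!≡p! = trans (cong (_* (k ! * (p ∸ k) !)) (nCk≡n!/k![n-k]! (<⇒≤ k<p)))
      (m/n*n≡m (k![n∸k]!∣n! (<⇒≤ k<p)))
    n∣n! : ∀ {n} → 0 < n → n ∣ n !
    n∣n! {suc n} _ = m∣m*n (n !)
    p∣product : p ∣ (p C k) * (k ! * (p ∸ k) !)
    p∣product = subst (p ∣_) (sym C*k!*[p∸k]!≡p!) (n∣n! (<-trans 0<k k<p))
  ... | inj₁ p∣C = p∣C
  ... | inj₂ p∣k!*[p∸k]! with euclidsLemma (k !) ((p ∸ k) !) p-prime p∣k!*[p∸k]!
  ...   | inj₁ p∣k!     = contradiction p∣k! (prime∤! p-prime k<p)
  ...   | inj₂ p∣[p∸k]! = contradiction p∣[p∸k]! (prime∤! p-prime (∸-monoʳ-< 0<k (<⇒≤ k<p)))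

  module PrimePowers {p} (p-prime : PrimeNumber p) where

    private
      instance
        p≢0 : NonZero p
        p≢0 = >-nonZero (<-trans z<s (prime>1 p-prime))

    ^-injective : ∀ {m n} → p ^ m ≡ p ^ n → m ≡ n
    ^-injective {m} {n} eq = ≤-antisym (≮⇒≥ λ n<m → <⇒≢ (^-monoʳ-< p (prime>1 p-prime) n<m) (sym eq))
      (≮⇒≥ λ m<n → <⇒≢ (^-monoʳ-< p (prime>1 p-prime) m<n) eq)

    n<p^n : ∀ n → n < p ^ n
    n<p^n zero    = z<s
    n<p^n (suc n) = begin-strict
      suc n         ≤⟨ n<p^n n ⟩
      p ^ n         <⟨ m<m*n (p ^ n) p ⦃ m^n≢0 p n ⦄ (prime>1 p-prime) ⟩
      p ^ n * p     ≡⟨ *-comm (p ^ n) p ⟩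
      p ^ suc n     ∎
      where open ≤-Reasoning

    -- This number is the pole order of `τ ^ (p ^ n) * τ` when `τ` has a simple pole.
    p∤1+p^ : ∀ {n} → 0 < n → p ∤ suc (p ^ n)
    p∤1+p^ {suc n} _ p∣ = contradiction (∣1⇒≡1 (∣m+n∣m⇒∣n (subst (p ∣_) (+-comm 1 (p ^ suc n)) p∣) (m∣m*n (p ^ n))))
      (>⇒≢ (prime>1 p-prime))

    -- A Euclidean step: modulo pᵐ - 1, the exponent in pⁿ - 1 may be lowered by m.
    pred-p^-split : ∀ m r → pred (p ^ (m + r)) ≡ p ^ r * pred (p ^ m) + pred (p ^ r)
    pred-p^-split m r = suc-injective (begin
      suc (pred (p ^ (m + r)))                   ≡⟨ suc-pred _ ⦃ m^n≢0 p (m + r) ⦄ ⟩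
      p ^ (m + r)                                ≡⟨ ^-distribˡ-+-* p m r ⟩
      p ^ m * p ^ r                              ≡⟨ cong (_* p ^ r) (suc-pred (p ^ m) ⦃ m^n≢0 p m ⦄) ⟨
      suc (pred (p ^ m)) * p ^ r                 ≡⟨ cong (λ k → p ^ r + k) (*-comm (pred (p ^ m)) (p ^ r)) ⟩
      p ^ r + p ^ r * pred (p ^ m)               ≡⟨ +-comm (p ^ r) _ ⟩
      p ^ r * pred (p ^ m) + p ^ r               ≡⟨ cong (λ k → p ^ r * pred (p ^ m) + k) (suc-pred (p ^ r) ⦃ m^n≢0 p r ⦄) ⟨
      p ^ r * pred (p ^ m) + suc (pred (p ^ r))  ≡⟨ +-suc (p ^ r * pred (p ^ m)) _ ⟩
      suc (p ^ r * pred (p ^ m) + pred (p ^ r))  ∎)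
      where open ≡-Reasoning

    -- Lower n by m as long as m ≤ n. Once n < m, the number pⁿ - 1 is smaller than pᵐ - 1, so it is
    -- divisible only if it vanishes, that is, if n = 0.
    pred-p^-∣⇒∣ : ∀ {m} → 0 < m → ∀ n → pred (p ^ m) ∣ pred (p ^ n) → m ∣ n
    pred-p^-∣⇒∣ {m} 0<m = <-rec _ step
      where
      step : ∀ n → (∀ {k} → k < n → pred (p ^ m) ∣ pred (p ^ k) → m ∣ k) → pred (p ^ m) ∣ pred (p ^ n) → m ∣ n
      step n rec div with m ≤? n
      ... | yes m≤n = subst (m ∣_) (m+[n∸m]≡n m≤n) (∣m∣n⇒∣m+n ∣-refl (rec (∸-monoʳ-< 0<m m≤n)
        (∣m+n∣m⇒∣n (subst (pred (p ^ m) ∣_) (trans (cong (λ k → pred (p ^ k)) (sym (m+[n∸m]≡n m≤n)))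
          (pred-p^-split m (n ∸ m))) div) (n∣m*n (p ^ (n ∸ m))))))
      step zero    rec div | no m≰n = m ∣0
      step (suc n) rec div | no m≰n = contradiction (∣⇒≤ ⦃ >-nonZero pred>0 ⦄ div)
        (<⇒≱ (pred-mono-< ⦃ m^n≢0 p (suc n) ⦄ (^-monoʳ-< p (prime>1 p-prime) (≰⇒> m≰n))))
        where
        pred>0 : 0 < pred (p ^ suc n)
        pred>0 = pred-mono-< {1} (≤-<-trans (s≤s z≤n) (n<p^n (suc n)))

    -- e = 1 + pᵐ + ⋯ + p⁽ᑫ⁻¹⁾ᵐ
    geometric : ∀ m q → ∃[ e ] e + p ^ (q * m) ≡ p ^ m * e + 1
    geometric m zero = 0 , cong (_+ 1) (sym (*-zeroʳ (p ^ m)))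
    geometric m (suc q) with geometric m q
    ... | e , eq = e + p ^ (q * m) , (begin
      e + p ^ (q * m) + p ^ (m + q * m)          ≡⟨ cong₂ _+_ eq (^-distribˡ-+-* p m (q * m)) ⟩
      p ^ m * e + 1 + p ^ m * p ^ (q * m)        ≡⟨ solve 3 (λ b e x → b :* e :+ con 1 :+ b :* x := b :* (e :+ x) :+ con 1) refl
                                                   (p ^ m) e (p ^ (q * m)) ⟩
      p ^ m * (e + p ^ (q * m)) + 1              ∎)
      where
      open ≡-Reasoning
      open ℕ-Solver.+-*-Solver

-- The Frobenius map and Artin-Schreier equivalence in characteristic p.

module ArtinSchreier {c ℓ} (K : CommutativeRing c ℓ)
  {p} (p-prime : PrimeNumber p) (char : HasCharacteristic K p) where

  open CommutativeRing K hiding (zero)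
  open SExp semiring public using (_^_; ^-congˡ; ^-congʳ; ^-homo-*; ^-assocʳ)
  open CSExp commutativeSemiring public using (^-distrib-*)
  open Mult semiring using (×-assocˡ; ×-comm-*; ×-congʳ; ×-homo-1) renaming (_×_ to _·_)
  open SumProperties semiring using (sum; sum-cong-≋; sum-replicate-zero; sum-init-last)
  open RingProperties ring using (+-inverseʳ-unique)
  open RingSolver commutativeSemiring using (solve; _:=_; _:+_; _:*_)
  open SetoidReasoning setoid

  private
    variable
      w x y z : Carrier

  p∣⇒·≈0 : ∀ {n} → p ∣ n → ∀ x → n · x ≈ 0#
  p∣⇒·≈0 (divides q ≡.refl) x = begin
    (q ℕ.* p) · x            ≈⟨ ×-assocˡ x q p ⟨
    q · (p · x)              ≈⟨ ×-congʳ q (×-congʳ p (*-identityʳ x)) ⟨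
    q · (p · (x * 1#))       ≈⟨ ×-congʳ q (×-comm-* p x 1#) ⟨
    q · (x * (p · 1#))       ≈⟨ ×-congʳ q (*-congˡ (from (char p) ∣-refl)) ⟩
    q · (x * 0#)             ≈⟨ ×-comm-* q x 0# ⟨
    x * (q · 0#)             ≈⟨ *-congˡ (×-congʳ q (zeroʳ 0#)) ⟨
    x * (q · (0# * 0#))      ≈⟨ *-congˡ (×-comm-* q 0# 0#) ⟨
    x * (0# * (q · 0#))      ≈⟨ *-congˡ (zeroˡ _) ⟩
    x * 0#                   ≈⟨ zeroʳ x ⟩
    0#                       ∎

  -- The exponent is a variable equal to `p` so that it can be matched as a successor and the sum
  -- split into first, middle and last terms. The middle terms vanish because p divides their
  -- coefficients.
  binomialExpansion-prime : ∀ {n} → n ≡ p → Binomial.binomialExpansion commutativeSemiring x y n ≈ x ^ n + y ^ n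
  binomialExpansion-prime {n = ℕ.zero} ≡.refl with () ← prime>1 p-prime
  binomialExpansion-prime {x} {y} {n = ℕ.suc n} ≡.refl = begin
    term zero + sum (λ i → term (suc i))
      ≈⟨ +-congˡ (sum-init-last {n} (λ i → term (suc i))) ⟩
    term zero + (sum {n} (λ i → term (suc (inject₁ i))) + term (suc (fromℕ n)))
      ≈⟨ +-cong firstTerm (+-cong (trans (sum-cong-≋ {n} middleTerm) (sum-replicate-zero n)) lastTerm) ⟩
    y ^ p + (0# + x ^ p)
      ≈⟨ +-congˡ (+-identityˡ _) ⟩
    y ^ p + x ^ p
      ≈⟨ +-comm _ _ ⟩
    x ^ p + y ^ p ∎
    where
    term : Fin (ℕ.suc p) → Carrier
    term = Binomial.binomialTerm commutativeSemiring x y p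

    firstTerm : term zero ≈ y ^ p
    firstTerm = trans (×-homo-1 _) (*-identityˡ _)

    middleTerm : ∀ i → term (suc (inject₁ i)) ≈ 0#
    middleTerm i = p∣⇒·≈0 (prime∣binomial p-prime ℕ.z<s
      (ℕ.s<s (≡.subst (_< n) (≡.sym (toℕ-inject₁ i)) (toℕ<n i)))) _

    lastTerm : term (suc (fromℕ n)) ≈ x ^ p
    lastTerm rewrite toℕ-fromℕ n | nCn≡1 p | ℕ.n∸n≡0 p = trans (×-homo-1 _) (*-identityʳ _)

  ^p-distrib-+ : ∀ x y → (x + y) ^ p ≈ x ^ p + y ^ p
  ^p-distrib-+ x y = trans (Binomial.theorem commutativeSemiring p x y) (binomialExpansion-prime ≡.refl)

  0^p≈0 : 0# ^ p ≈ 0#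
  0^p≈0 = 0^n≈0 (ℕ.<-trans ℕ.z<s (prime>1 p-prime))
    where
    0^n≈0 : ∀ {n} → 0 < n → 0# ^ n ≈ 0#
    0^n≈0 {ℕ.suc n} _ = zeroˡ (0# ^ n)

  ^p-neg : ∀ x → (- x) ^ p ≈ - (x ^ p)
  ^p-neg x = +-inverseʳ-unique _ _ (begin
    x ^ p + (- x) ^ p  ≈⟨ ^p-distrib-+ x (- x) ⟨
    (x - x) ^ p        ≈⟨ ^-congˡ p (-‿inverseʳ x) ⟩
    0# ^ p             ≈⟨ 0^p≈0 ⟩
    0#                 ∎)

  -- Equality modulo the image of the Artin–Schreier map g ↦ gᵖ − g.
  infix 4 _∼_
  _∼_ : Carrier → Carrier → Set _
  x ∼ y = ∃[ g ] x + g ≈ y + g ^ p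

  ∼-reflexive : x ≈ y → x ∼ y
  ∼-reflexive x≈y = 0# , +-cong x≈y (sym 0^p≈0)

  ∼-sym : x ∼ y → y ∼ x
  ∼-sym {x} {y} (g , eq) = - g , (begin
    y - g                        ≈⟨ +-congʳ (trans (+-congˡ (-‿inverseʳ (g ^ p))) (+-identityʳ y)) ⟨
    y + (g ^ p - g ^ p) - g      ≈⟨ solve 4 (λ a b c d → a :+ (b :+ c) :+ d := (a :+ b) :+ (c :+ d)) refl y (g ^ p) (- (g ^ p)) (- g) ⟩
    y + g ^ p + (- (g ^ p) - g)  ≈⟨ +-congʳ eq ⟨
    x + g + (- (g ^ p) - g)      ≈⟨ solve 4 (λ a b c d → (a :+ b) :+ (c :+ d) := a :+ (b :+ d) :+ c) refl x g (- (g ^ p)) (- g) ⟩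
    x + (g - g) - g ^ p          ≈⟨ +-cong (trans (+-congˡ (-‿inverseʳ g)) (+-identityʳ x)) (sym (^p-neg g)) ⟩
    x + (- g) ^ p                ∎)

  ∼-trans : x ∼ y → y ∼ z → x ∼ z
  ∼-trans {x} {y} {z} (g , eq) (h , eq′) = g + h , (begin
    x + (g + h)            ≈⟨ +-assoc x g h ⟨
    x + g + h              ≈⟨ +-congʳ eq ⟩
    y + g ^ p + h          ≈⟨ solve 3 (λ a b c → a :+ b :+ c := a :+ c :+ b) refl y (g ^ p) h ⟩
    y + h + g ^ p          ≈⟨ +-congʳ eq′ ⟩
    z + h ^ p + g ^ p      ≈⟨ solve 3 (λ a b c → a :+ b :+ c := a :+ (c :+ b)) refl z (h ^ p) (g ^ p) ⟩
    z + (g ^ p + h ^ p)    ≈⟨ +-congˡ (^p-distrib-+ g h) ⟨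
    z + (g + h) ^ p        ∎)

  ∼-resp : w ≈ x → y ≈ z → w ∼ y → x ∼ z
  ∼-resp w≈x y≈z w∼y = ∼-trans (∼-reflexive (sym w≈x)) (∼-trans w∼y (∼-reflexive y≈z))

  ^-suc-p^ : ∀ x j → x ^ (p ℕ.^ ℕ.suc j) ≈ (x ^ (p ℕ.^ j)) ^ p
  ^-suc-p^ x j = trans (^-congʳ x (ℕ.*-comm p (p ℕ.^ j))) (sym (^-assocʳ x (p ℕ.^ j) p))

  ^p^-∼ : ∀ x j → x ^ (p ℕ.^ j) ∼ x
  ^p^-∼ x ℕ.zero    = ∼-reflexive (*-identityʳ x)
  -- For `z = x ^ (p ^ j)`, the relation `z ^ p ∼ z` holds with `z` itself as witness.
  ^p^-∼ x (ℕ.suc j) = ∼-trans (∼-reflexive (^-suc-p^ x j)) (∼-trans (x ^ (p ℕ.^ j) , +-comm _ _) (^p^-∼ x j))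

  ∼⇒-∼0 : x ∼ y → x - y ∼ 0#
  ∼⇒-∼0 {x} {y} (g , eq) = g , (begin
    x - y + g            ≈⟨ solve 3 (λ a b c → a :+ b :+ c := a :+ c :+ b) refl x (- y) g ⟩
    x + g - y            ≈⟨ +-congʳ eq ⟩
    y + g ^ p - y        ≈⟨ solve 3 (λ a b c → a :+ b :+ c := (a :+ c) :+ b) refl y (g ^ p) (- y) ⟩
    y - y + g ^ p        ≈⟨ +-congʳ (-‿inverseʳ y) ⟩
    0# + g ^ p           ∎)

-- Zero divisors in fields and primality of the characteristic.

module FieldProperties {c ℓ} (K : CommutativeRing c ℓ)
  (isField : IsField K) where

  open CommutativeRing K hiding (zero)
  open IsField isField public
  open Mult semiring using (×1-homo-*; ×-homo-1) renaming (_×_ to _·_)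
  open SetoidReasoning setoid

  *-cancel-≈0 : ∀ {x y} → x ≉ 0# → x * y ≈ 0# → y ≈ 0#
  *-cancel-≈0 {x} {y} x≉0 xy≈0 with inverse x x≉0
  ... | x⁻¹ , xx⁻¹≈1 = begin
    y              ≈⟨ *-identityˡ y ⟨
    1# * y         ≈⟨ *-congʳ (trans (*-comm x⁻¹ x) xx⁻¹≈1) ⟨
    x⁻¹ * x * y    ≈⟨ *-assoc x⁻¹ x y ⟩
    x⁻¹ * (x * y)  ≈⟨ *-congˡ xy≈0 ⟩
    x⁻¹ * 0#       ≈⟨ zeroʳ x⁻¹ ⟩
    0#             ∎

  *-≉0 : ∀ {x y} → x ≉ 0# → y ≉ 0# → x * y ≉ 0#
  *-≉0 x≉0 y≉0 xy≈0 = y≉0 (*-cancel-≈0 x≉0 xy≈0)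

  inverse-≉0 : ∀ {x y} → x * y ≈ 1# → x ≉ 0#
  inverse-≉0 xy≈1 x≈0 = 1≉0 (trans (sym xy≈1) (trans (*-congʳ x≈0) (zeroˡ _)))

  -- A factorisation p = q d with 1 < d < p gives (d · 1)(q · 1) = 0 with d · 1 nonzero, so q · 1 =
  -- 0 and p divides the smaller number q.
  characteristic-prime : ∀ {p} → 0 < p → HasCharacteristic K p → PrimeNumber p
  characteristic-prime {ℕ.suc ℕ.zero} _ char = contradiction
    (trans (sym (×-homo-1 1#)) (from (char 1) (divides 1 ≡.refl))) 1≉0
  characteristic-prime {p@(ℕ.suc (ℕ.suc _))} _ char = Primality.prime λ where
    (hasNonTrivialDivisor {divisor = d} ⦃ d>1 ⦄ d<p (divides ℕ.zero ()))
    (hasNonTrivialDivisor {divisor = d} ⦃ d>1 ⦄ d<p (divides q@(ℕ.suc _) p≡qd)) →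
      let
        d≉0 : d · 1# ≉ 0#
        d≉0 d≈0 = contradiction (∣⇒≤ ⦃ ℕ.nonTrivial⇒nonZero d ⦃ d>1 ⦄ ⦄ (to (char d) d≈0)) (ℕ.<⇒≱ d<p)
        q<p : q < p
        q<p = ≡.subst (q <_) (≡.sym p≡qd) (ℕ.m<m*n q d (ℕ.nonTrivial⇒n>1 d ⦃ d>1 ⦄))
        dq≈0 : (d · 1#) * (q · 1#) ≈ 0#
        dq≈0 = trans (*-comm _ _) (trans (sym (×1-homo-* q d))
          (≡.subst (λ n → n · 1# ≈ 0#) p≡qd (from (char p) ∣-refl)))
      in contradiction (∣⇒≤ (to (char q) (*-cancel-≈0 d≉0 dq≈0))) (ℕ.<⇒≱ q<p)

-- Orders at a prime and the Artin-Schreier image.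

module Valuation {c ℓ f} (K : CommutativeRing c ℓ)
  {F : Pred (CommutativeRing.Carrier K) f} (isField : IsField K) (isSubfield : IsSubfield K F) (𝔮 : Prime K F)
  {p} (p-prime : PrimeNumber p) (char : HasCharacteristic K p) where

  open CommutativeRing K hiding (zero)
  open FieldProperties K isField
  open IsSubfield isSubfield using (1-closed; neg-closed)
  open Prime 𝔮
  open ArtinSchreier K p-prime char
  open RingProperties ring using (-1*x≈-x; -0#≈0#; -‿involutive)
    renaming (x∙y⁻¹≈ε⇒x≈y to x-y≈0⇒x≈y)
  open SetoidReasoning setoid

  private
    variable
      s x y : Carrier

  x≈0⇒-x≈0 : x ≈ 0# → - x ≈ 0#
  x≈0⇒-x≈0 x≈0 = trans (-‿cong x≈0) -0#≈0#

  -‿≉0 : x ≉ 0# → - x ≉ 0#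
  -‿≉0 {x} x≉0 -x≈0 = x≉0 (trans (sym (-‿involutive x)) (x≈0⇒-x≈0 -x≈0))

  ^-≉0 : x ≉ 0# → ∀ n → x ^ n ≉ 0#
  ^-≉0 x≉0 ℕ.zero    = 1≉0
  ^-≉0 x≉0 (ℕ.suc n) = *-≉0 x≉0 (^-≉0 x≉0 n)

  -- -1 is a constant and so has order 0.
  ord-neg : (x≉0 : x ≉ 0#) (-x≉0 : - x ≉ 0#) → ord (- x) -x≉0 ≡ ord x x≉0
  ord-neg {x} x≉0 -x≉0 = ≡.trans (ord-cong -x≉0 -1*x≉0 (sym (-1*x≈-x x)))
    (≡.trans (ord-* -1≉0 x≉0 -1*x≉0)
      (≡.trans (≡.cong (ℤ._+ ord x x≉0) (constant -1≉0 (neg-closed 1-closed))) (ℤ.+-identityˡ _)))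
    where
    -1≉0 = -‿≉0 1≉0
    -1*x≉0 = *-≉0 -1≉0 x≉0

  ord-^ : (x≉0 : x ≉ 0#) → ∀ n → (xⁿ≉0 : x ^ n ≉ 0#) → ord (x ^ n) xⁿ≉0 ≡ + n ℤ.* ord x x≉0
  ord-^ x≉0 ℕ.zero    1≉0  = ≡.trans (constant 1≉0 1-closed) (≡.sym (ℤ.*-zeroˡ (ord _ x≉0)))
  ord-^ x≉0 (ℕ.suc n) xⁿ≉0 = ≡.trans (ord-* x≉0 (^-≉0 x≉0 n) xⁿ≉0)
    (≡.trans (≡.cong (ℤ._+_ (ord _ x≉0)) (ord-^ x≉0 n (^-≉0 x≉0 n)))
      (≡.sym (ℤ.suc-* (+ n) (ord _ x≉0))))

  -- The ultrametric inequality is applied twice, to x + y and to x = (x + y) - y.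
  ord-+-< : (x≉0 : x ≉ 0#) (y≉0 : y ≉ 0#) (x+y≉0 : x + y ≉ 0#) →
    ord x x≉0 ℤ.< ord y y≉0 → ord (x + y) x+y≉0 ≡ ord x x≉0
  ord-+-< {x} {y} x≉0 y≉0 x+y≉0 x<y = ℤ.≤-antisym x+y≤x x≤x+y
    where
    x+y-y≈x : x + y - y ≈ x
    x+y-y≈x = trans (+-assoc x y (- y)) (trans (+-congˡ (-‿inverseʳ y)) (+-identityʳ x))

    x+y-y≉0 : x + y - y ≉ 0#
    x+y-y≉0 eq = x≉0 (trans (sym x+y-y≈x) eq)

    bound : ord (x + y) x+y≉0 ℤ.⊓ ord y y≉0 ℤ.≤ ord x x≉0
    bound = ≡.subst₂ (λ i j → ord (x + y) x+y≉0 ℤ.⊓ i ℤ.≤ j)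
      (ord-neg y≉0 (-‿≉0 y≉0)) (ord-cong x+y-y≉0 x≉0 x+y-y≈x) (ord-+ x+y≉0 (-‿≉0 y≉0) x+y-y≉0)

    x+y≤x : ord (x + y) x+y≉0 ℤ.≤ ord x x≉0
    -- The minimum in `bound` cannot be `ord y`, which exceeds `ord x`.
    x+y≤x with ℤ.⊓-sel (ord (x + y) x+y≉0) (ord y y≉0)
    ... | inj₁ eq = ≡.subst (ℤ._≤ _) eq bound
    ... | inj₂ eq = contradiction (≡.subst (ℤ._≤ _) eq bound) (ℤ.<⇒≱ x<y)

    x≤x+y : ord x x≉0 ℤ.≤ ord (x + y) x+y≉0
    x≤x+y = ≡.subst (ℤ._≤ _) (ℤ.i≤j⇒i⊓j≡i (ℤ.<⇒≤ x<y)) (ord-+ x≉0 y≉0 x+y≉0)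

  -- A pole of s = gᵖ − g is a pole of g, where gᵖ dominates.
  ∼0⇒p∣ord : (s≉0 : s ≉ 0#) → s ∼ 0# → ord s s≉0 ℤ.< 0ℤ → ∃[ γ ] ord s s≉0 ≡ + p ℤ.* γ
  ∼0⇒p∣ord {s} s≉0 (g , s+g≈0+gᵖ) ord-s<0 = ord g g≉0 , ≡.trans ord-s≡ (ord-^ g≉0 p gᵖ≉0)
    where
    s≈gᵖ-g : s ≈ g ^ p - g
    s≈gᵖ-g = begin
      s              ≈⟨ +-identityʳ s ⟨
      s + 0#         ≈⟨ +-congˡ (-‿inverseʳ g) ⟨
      s + (g - g)    ≈⟨ +-assoc s g (- g) ⟨
      s + g - g      ≈⟨ +-congʳ (trans s+g≈0+gᵖ (+-identityˡ _)) ⟩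
      g ^ p - g      ∎

    g≉0 : g ≉ 0#
    g≉0 g≈0 = s≉0 (trans s≈gᵖ-g (trans (+-cong (trans (^-congˡ p g≈0) 0^p≈0) (x≈0⇒-x≈0 g≈0)) (+-identityˡ 0#)))

    gᵖ≉0 = ^-≉0 g≉0 p
    -g≉0 = -‿≉0 g≉0

    gᵖ-g≉0 : g ^ p - g ≉ 0#
    gᵖ-g≉0 eq = s≉0 (trans s≈gᵖ-g eq)

    -- If g had no pole, neither would gᵖ - g = s.
    0≰ord-g : ¬ (0ℤ ℤ.≤ ord g g≉0)
    0≰ord-g 0≤γ = ℤ.<⇒≱ ord-s<0 (ℤ.≤-trans (ℤ.⊓-glb 0≤ord-gᵖ 0≤ord-[-g])
      (≡.subst (ord (g ^ p) gᵖ≉0 ℤ.⊓ ord (- g) -g≉0 ℤ.≤_) (ord-cong gᵖ-g≉0 s≉0 (sym s≈gᵖ-g)) (ord-+ gᵖ≉0 -g≉0 gᵖ-g≉0)))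
      where
      0≤ord-[-g] : 0ℤ ℤ.≤ ord (- g) -g≉0
      0≤ord-[-g] = ≡.subst (0ℤ ℤ.≤_) (≡.sym (ord-neg g≉0 -g≉0)) 0≤γ
      0≤ord-gᵖ : 0ℤ ℤ.≤ ord (g ^ p) gᵖ≉0
      0≤ord-gᵖ = ≡.subst₂ ℤ._≤_ (ℤ.*-zeroʳ (+ p)) (≡.sym (ord-^ g≉0 p gᵖ≉0)) (ℤ.*-monoˡ-≤-nonNeg (+ p) 0≤γ)

    -- Multiplying 1 < p by the negative number `ord g` reverses the inequality.
    ord-gᵖ<ord-g : ord (g ^ p) gᵖ≉0 ℤ.< ord (- g) -g≉0
    ord-gᵖ<ord-g = ≡.subst₂ ℤ._<_ (≡.sym (ord-^ g≉0 p gᵖ≉0)) (≡.trans (ℤ.*-identityˡ _) (≡.sym (ord-neg g≉0 -g≉0)))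
      (ℤ.*-monoʳ-<-neg (ord g g≉0) ⦃ ℤ.negative (ℤ.≰⇒> 0≰ord-g) ⦄ (+<+ (prime>1 p-prime)))

    ord-s≡ : ord s s≉0 ≡ ord (g ^ p) gᵖ≉0
    ord-s≡ = ≡.trans (ord-cong s≉0 gᵖ-g≉0 s≈gᵖ-g) (ord-+-< gᵖ≉0 -g≉0 gᵖ-g≉0 ord-gᵖ<ord-g)

  -- Powers of an element with a simple pole.

  module SimplePole {τ} (τ≉0 : CommutativeRing._≉_ K τ (CommutativeRing.0# K)) (ord-τ : ord τ τ≉0 ≡ -1ℤ) where

    τ^n≉0 = ^-≉0 τ≉0

    ord-τ^ : ∀ n → ord (τ ^ n) (τ^n≉0 n) ≡ ℤ.- + n
    ord-τ^ n = ≡.trans (ord-^ τ≉0 n (τ^n≉0 n)) (≡.trans (≡.cong (ℤ._*_ (+ n)) ord-τ)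
      (≡.trans (ℤ.*-comm (+ n) -1ℤ) (ℤ.-1*i≡-i (+ n))))

    τ^-injective : ∀ {m n} → τ ^ m ≈ τ ^ n → m ≡ n
    τ^-injective {m} {n} eq = ℤ.+-injective (ℤ.neg-injective (≡.trans (≡.sym (ord-τ^ m))
      (≡.trans (ord-cong (τ^n≉0 m) (τ^n≉0 n) eq) (ord-τ^ n))))

    -- The difference τⁿ - τᵐ has order -n, as its first term dominates; a pole of an element
    -- equivalent to 0 has order divisible by p.
    τ^-≁ : ∀ {m n} → m < n → p ∤ n → ¬ (τ ^ n ∼ τ ^ m)
    τ^-≁ {m} {n} m<n p∤n τⁿ∼τᵐ = p∤n (p∣n (∼0⇒p∣ord δ≉0 (∼⇒-∼0 τⁿ∼τᵐ) ord-δ<0))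
      where
      δ = τ ^ n - τ ^ m
      δ≉0 : δ ≉ 0#
      δ≉0 δ≈0 = ℕ.<⇒≢ m<n (≡.sym (τ^-injective (x-y≈0⇒x≈y _ _ δ≈0)))
      -τᵐ≉0 = -‿≉0 (τ^n≉0 m)
      ord-δ : ord δ δ≉0 ≡ ℤ.- + n
      ord-δ = ≡.trans (ord-+-< (τ^n≉0 n) -τᵐ≉0 δ≉0 (≡.subst₂ ℤ._<_ (≡.sym (ord-τ^ n))
        (≡.sym (≡.trans (ord-neg (τ^n≉0 m) -τᵐ≉0) (ord-τ^ m))) (ℤ.neg-mono-< (+<+ m<n)))) (ord-τ^ n)
      ord-δ<0 : ord δ δ≉0 ℤ.< 0ℤ
      ord-δ<0 = ≡.subst (ℤ._< 0ℤ) (≡.sym ord-δ) (ℤ.neg-mono-< (+<+ (ℕ.≤-<-trans ℕ.z≤n m<n)))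
      p∣n : ∃[ γ ] ord δ δ≉0 ≡ + p ℤ.* γ → p ∣ n
      p∣n (γ , eq) = ≡.subst (p ∣_) (≡.sym (≡.trans (≡.sym (ℤ.∣-i∣≡∣i∣ (+ n)))
        (≡.trans (≡.cong ℤ.∣_∣ (≡.trans (≡.sym ord-δ) eq)) (ℤ.abs-* (+ p) γ)))) (m∣m*n ℤ.∣ γ ∣)

    p*-1≢p* : ∀ {i} γ γ′ → i ≡ + p ℤ.* γ → i ℤ.+ -1ℤ ≢ + p ℤ.* γ′
    p*-1≢p* γ γ′ ≡.refl eq = contradiction (∣1⇒≡1 p∣1) (ℕ.>⇒≢ (prime>1 p-prime))
      where
      p*[γ-γ′]≡1 : + p ℤ.* (γ ℤ.- γ′) ≡ 1ℤ
      p*[γ-γ′]≡1 = ≡.trans (solve 3 (λ p γ γ′ → p :* (γ :- γ′) := p :* γ :- p :* γ′) ≡.refl (+ p) γ γ′)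
        (≡.trans (≡.cong (ℤ._-_ (+ p ℤ.* γ)) (≡.sym eq))
          (solve 1 (λ a → a :- (a :+ con -1ℤ) := con 1ℤ) ≡.refl (+ p ℤ.* γ)))
        where open +-*-Solver
      p∣1 : p ∣ 1
      p∣1 = ≡.subst (p ∣_) (≡.trans (≡.sym (ℤ.abs-* (+ p) (γ ℤ.- γ′))) (≡.cong ℤ.∣_∣ p*[γ-γ′]≡1)) (m∣m*n ℤ.∣ γ ℤ.- γ′ ∣)

    -- For large k both products have a pole at 𝔮, and their orders differ by 1.
    ∼0-multiples⇒≈0 : (∀ k → 0 < k → s * τ ^ (p ℕ.^ k) ∼ 0# × s * τ ^ (p ℕ.^ k) * τ ∼ 0#) → ¬ s ≉ 0#
    ∼0-multiples⇒≈0 {s} h s≉0 =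
      let γ  , eq  = ∼0⇒p∣ord sτ^≉0 (proj₁ (h k ℕ.z<s)) ord<0
          γ′ , eq′ = ∼0⇒p∣ord sτ^τ≉0 (proj₂ (h k ℕ.z<s)) ord′<0
      in p*-1≢p* γ γ′ eq (≡.trans (≡.sym ord′≡) eq′)
      where
      -- As pᵏ > k > |ord s|, the pole of `τ ^ (p ^ k)` outweighs any zero of `s`; the successor
      -- also makes k positive.
      k = ℕ.suc ℤ.∣ ord s s≉0 ∣
      sτ^≉0 = *-≉0 s≉0 (τ^n≉0 (p ℕ.^ k))
      sτ^τ≉0 = *-≉0 sτ^≉0 τ≉0

      ord-s<p^k : ord s s≉0 ℤ.< + (p ℕ.^ k)
      ord-s<p^k = ℤ.≤-<-trans (i≤+∣i∣ (ord s s≉0))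
        (+<+ (ℕ.<-trans (ℕ.n<1+n _) (PrimePowers.n<p^n p-prime k)))
        where
        i≤+∣i∣ : ∀ i → i ℤ.≤ + ℤ.∣ i ∣
        i≤+∣i∣ (+ n)      = ℤ.≤-refl
        i≤+∣i∣ ℤ.-[1+ n ] = ℤ.-≤+

      ord<0 : ord _ sτ^≉0 ℤ.< 0ℤ
      ord<0 = ≡.subst₂ ℤ._<_
        (≡.trans (≡.cong (ℤ._+_ (ord s s≉0)) (≡.sym (ord-τ^ (p ℕ.^ k)))) (≡.sym (ord-* s≉0 (τ^n≉0 (p ℕ.^ k)) sτ^≉0)))
        (ℤ.+-inverseʳ (+ (p ℕ.^ k))) (ℤ.+-monoˡ-< (ℤ.- + (p ℕ.^ k)) ord-s<p^k)

      ord′≡ : ord _ sτ^τ≉0 ≡ ord _ sτ^≉0 ℤ.+ -1ℤ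
      ord′≡ = ≡.trans (ord-* sτ^≉0 τ≉0 sτ^τ≉0) (≡.cong (ℤ._+_ (ord _ sτ^≉0)) ord-τ)

      ord′<0 : ord _ sτ^τ≉0 ℤ.< 0ℤ
      ord′<0 = ≡.subst (ℤ._< 0ℤ) (≡.sym ord′≡) (ℤ.+-mono-< ord<0 (ℤ.-<+ {0} {0}))

-- Addition, Frobenius images and divisibility expressed through powers of τ.

module FrobeniusPowers {c ℓ f} (K : CommutativeRing c ℓ)
  {F : Pred (CommutativeRing.Carrier K) f} (isField : IsField K) (isSubfield : IsSubfield K F) (𝔮 : Prime K F)
  {p} (p-prime : PrimeNumber p) (char : HasCharacteristic K p)
  {τ} (τ≉0 : CommutativeRing._≉_ K τ (CommutativeRing.0# K)) (ord-τ : Prime.ord 𝔮 τ τ≉0 ≡ -1ℤ) where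

  open CommutativeRing K hiding (zero)
  open FieldProperties K isField
  open Prime 𝔮 using (ord; ord-cong; ord-*)
  open ArtinSchreier K p-prime char
  open PrimePowers p-prime
  open Valuation K isField isSubfield 𝔮 p-prime char
  open SimplePole τ≉0 ord-τ
  open RingProperties ring using ([y-z]x≈yx-zx) renaming (x∙y⁻¹≈ε⇒x≈y to x-y≈0⇒x≈y)
  open SetoidReasoning setoid

  private
    variable
      g h q v w x y z : Carrier

  infix 9 _⟨_⟩
  _⟨_⟩ : Carrier → ℕ → Carrier
  x ⟨ s ⟩ = x ^ (p ℕ.^ s)

  IsPPower : Carrier → Set ℓ
  IsPPower x = pPowers K p τ (x ∷ [])

  ⟨⟩-cong : ∀ s → x ≈ y → x ⟨ s ⟩ ≈ y ⟨ s ⟩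
  ⟨⟩-cong s = ^-congˡ (p ℕ.^ s)

  ⟨⟩-+ : ∀ x j k → x ⟨ j ℕ.+ k ⟩ ≈ x ⟨ j ⟩ ⟨ k ⟩
  ⟨⟩-+ x j k = trans (^-congʳ x (ℕ.^-distribˡ-+-* p j k)) (sym (^-assocʳ x (p ℕ.^ j) (p ℕ.^ k)))

  τ⟨⟩-suc : ∀ s → x ≈ τ ⟨ s ⟩ → x ^ p ≈ τ ⟨ ℕ.suc s ⟩
  τ⟨⟩-suc s x≈ = trans (^-congˡ p x≈) (sym (^-suc-p^ τ s))

  τ⟨⟩-injective : ∀ m n → τ ⟨ m ⟩ ≈ τ ⟨ n ⟩ → m ≡ n
  τ⟨⟩-injective m n eq = ^-injective (τ^-injective eq)

  -- The pole orders are pᵐ + 1 and pⁿ + 1. If they differ, the larger one comes from a positive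
  -- exponent and is prime to p, so `τ^-≁` separates the two products.
  τ⟨⟩*τ-injective : ∀ m n → 0 < n → τ ⟨ m ⟩ * τ ∼ τ ⟨ n ⟩ * τ → m ≡ n
  τ⟨⟩*τ-injective m n 0<n eq with ℕ.<-cmp m n
  ... | tri≈ _ m≡n _ = m≡n
  ... | tri< m<n _ _ = contradiction (∼-resp (*-comm _ _) (*-comm _ _) (∼-sym eq))
    (τ^-≁ (ℕ.s<s (ℕ.^-monoʳ-< p (prime>1 p-prime) m<n)) (p∤1+p^ 0<n))
  ... | tri> _ _ n<m = contradiction (∼-resp (*-comm _ _) (*-comm _ _) eq)
    (τ^-≁ (ℕ.s<s (ℕ.^-monoʳ-< p (prime>1 p-prime) n<m)) (p∤1+p^ (ℕ.<-trans 0<n n<m)))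

  -- The left side is the k-th Frobenius image of the right side.
  τ⟨⟩*τ⟨⟩-∼ : ∀ j k → τ ⟨ j ℕ.+ k ⟩ * τ ⟨ k ⟩ ∼ τ ⟨ j ⟩ * τ
  τ⟨⟩*τ⟨⟩-∼ j k = ∼-trans
    (∼-reflexive (trans (*-congʳ (⟨⟩-+ τ j k)) (sym (^-distrib-* (τ ⟨ j ⟩) τ (p ℕ.^ k)))))
    (^p^-∼ (τ ⟨ j ⟩ * τ) k)

  -- Removing min(m, n) Frobenius steps from the product leaves `τ ⟨ j ⟩ * τ` with j = |m - n|, and
  -- then j = k. The product is symmetric in m and n, whence the two alternatives.
  τ⟨⟩*τ⟨⟩-∼⇒ : ∀ k m n → 0 < k → τ ⟨ m ⟩ * τ ⟨ n ⟩ ∼ τ ⟨ k ⟩ * τ → m ≡ k ℕ.+ n ⊎ n ≡ k ℕ.+ m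
  τ⟨⟩*τ⟨⟩-∼⇒ k m n 0<k eq with ℕ.≤-total n m
  ... | inj₁ n≤m with j , n+j≡m ← ℕ.m≤n⇒∃[o]m+o≡n n≤m
                   with ≡.refl ← ≡.trans (ℕ.+-comm j n) n+j≡m
    = inj₁ (≡.cong (ℕ._+ n) (τ⟨⟩*τ-injective j k 0<k (∼-trans (∼-sym (τ⟨⟩*τ⟨⟩-∼ j n)) eq)))
  ... | inj₂ m≤n with j , m+j≡n ← ℕ.m≤n⇒∃[o]m+o≡n m≤n
                   with ≡.refl ← ≡.trans (ℕ.+-comm j m) m+j≡n
    = inj₂ (≡.cong (ℕ._+ m) (τ⟨⟩*τ-injective j k 0<k
        (∼-trans (∼-sym (τ⟨⟩*τ⟨⟩-∼ j m)) (∼-resp (*-comm _ _) refl eq))))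

  -- The first equivalence says that the exponents satisfy n = k + m or m = k + n;
  -- the second, with k and n increased by 1, rules out m = k + n.
  Sum : Carrier → Carrier → Carrier → Set (c ⊔ ℓ)
  Sum x y z = IsPPower x × IsPPower y × IsPPower z × (z * y ∼ x * τ) × (z ^ p * y ∼ x ^ p * τ)

  Sum-intro : ∀ k m → 0 < k → 0 < m → x ≈ τ ⟨ k ⟩ → y ≈ τ ⟨ m ⟩ → z ≈ τ ⟨ k ℕ.+ m ⟩ → Sum x y z
  Sum-intro k@(ℕ.suc _) m@(ℕ.suc _) _ _ x≈ y≈ z≈ =
    ((k , _) , x≈) , ((m , _) , y≈) , ((k ℕ.+ m , _) , z≈) ,
    ∼-resp (sym (*-cong z≈ y≈)) (sym (*-congʳ x≈)) (τ⟨⟩*τ⟨⟩-∼ k m) ,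
    ∼-resp (sym (*-cong (τ⟨⟩-suc (k ℕ.+ m) z≈) y≈)) (sym (*-congʳ (τ⟨⟩-suc k x≈))) (τ⟨⟩*τ⟨⟩-∼ (ℕ.suc k) m)

  Sum-elim : Sum x y z → Σ[ k ∈ ℤ>0 ] Σ[ m ∈ ℤ>0 ] Σ[ n ∈ ℤ>0 ]
    (proj₁ k ℕ.+ proj₁ m ≡ proj₁ n) × (x ≈ τ ⟨ proj₁ k ⟩) × (y ≈ τ ⟨ proj₁ m ⟩) × (z ≈ τ ⟨ proj₁ n ⟩)
  Sum-elim (x∈ , y∈ , z∈ , zy∼xτ , zᵖy∼xᵖτ) with x∈ | y∈ | z∈
  ... | (ℕ.zero , record { nonZero = () }) , _ | _ | _
  ... | (k@(ℕ.suc _) , k≢0) , x≈ | (m , m≢0) , y≈ | (n , n≢0) , z≈ =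
    (k , k≢0) , (m , m≢0) , (n , n≢0) , k+m≡n , x≈ , y≈ , z≈
    where
    first : n ≡ k ℕ.+ m ⊎ m ≡ k ℕ.+ n
    first = τ⟨⟩*τ⟨⟩-∼⇒ k n m ℕ.z<s (∼-resp (*-cong z≈ y≈) (*-congʳ x≈) zy∼xτ)

    second : ℕ.suc n ≡ ℕ.suc k ℕ.+ m ⊎ m ≡ ℕ.suc k ℕ.+ ℕ.suc n
    second = τ⟨⟩*τ⟨⟩-∼⇒ (ℕ.suc k) (ℕ.suc n) m ℕ.z<s
      (∼-resp (*-cong (τ⟨⟩-suc n z≈) y≈) (*-congʳ (τ⟨⟩-suc k x≈)) zᵖy∼xᵖτ)

    k+m≡n : k ℕ.+ m ≡ n
    -- In the branch m = k + n, the second relation leaves the desired equation or m = (1 + k) + (1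
    -- + n), which exceeds k + n.
    k+m≡n = [ (λ n≡k+m → ≡.sym n≡k+m) , (λ m≡k+n →
      [ (λ 1+n≡1+k+m → ≡.sym (ℕ.suc-injective 1+n≡1+k+m))
      , (λ m≡1+k+1+n → contradiction (≡.trans (≡.sym m≡k+n) m≡1+k+1+n)
          (ℕ.<⇒≢ (ℕ.+-mono-< (ℕ.n<1+n k) (ℕ.n<1+n n))))
      ]′ second) ]′ first

  -- With q = τ ⟨ j ⟩, necessary for v = g ⟨ j ⟩.  The multipliers τ ⟨ m ⟩ and τ ⟨ m ⟩ * τ of g
  -- determine g, whereas their j-th Frobenius images alone would not determine v.
  Root : Carrier → Carrier → Carrier → Set (c ⊔ ℓ)
  Root v q g = ∀ u u′ → Sum q u u′ → (v * u′ ∼ g * u) × (v * u′ * q ∼ g * u * τ)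

  -- `Sum q u u′` forces `u′ ≈ u ⟨ j ⟩`. Hence `v * u′` and `v * u′ * q` are the j-th Frobenius
  -- images of `g * u` and `g * u * τ`, and Frobenius preserves the class modulo the Artin-Schreier
  -- image.
  Root-intro : ∀ j → q ≈ τ ⟨ j ⟩ → v ≈ g ⟨ j ⟩ → Root v q g
  Root-intro {q} {v} {g} j q≈ v≈ u u′ sum-quu′ with Sum-elim sum-quu′
  ... | (k , _) , (m , _) , (n , _) , k+m≡n , q≈′ , u≈ , u′≈ =
    ∼-trans (∼-reflexive vu′≈) (^p^-∼ (g * u) j) ,
    ∼-trans (∼-reflexive (trans (*-cong vu′≈ q≈) (sym (^-distrib-* (g * u) τ (p ℕ.^ j))))) (^p^-∼ (g * u * τ) j)
    where
    m+j≡n : m ℕ.+ j ≡ n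
    m+j≡n = ≡.trans (ℕ.+-comm m j) (≡.trans (≡.cong (ℕ._+ m) (τ⟨⟩-injective j k (trans (sym q≈) q≈′))) k+m≡n)

    vu′≈ : v * u′ ≈ (g * u) ⟨ j ⟩
    vu′≈ = begin
      v * u′                    ≈⟨ *-cong v≈ u′≈ ⟩
      g ⟨ j ⟩ * τ ⟨ n ⟩          ≡⟨ ≡.cong (λ n → g ⟨ j ⟩ * τ ⟨ n ⟩) m+j≡n ⟨
      g ⟨ j ⟩ * τ ⟨ m ℕ.+ j ⟩    ≈⟨ *-congˡ (⟨⟩-+ τ m j) ⟩
      g ⟨ j ⟩ * τ ⟨ m ⟩ ⟨ j ⟩    ≈⟨ *-congˡ (⟨⟩-cong j u≈) ⟨
      g ⟨ j ⟩ * u ⟨ j ⟩          ≈⟨ ^-distrib-* g u (p ℕ.^ j) ⟨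
      (g * u) ⟨ j ⟩              ∎

  -- Equality on K is not assumed decidable, so uniqueness holds only up to double negation;
  -- this suffices because divisibility in ℕ is decidable.
  Root-unique : ∀ j → 0 < j → q ≈ τ ⟨ j ⟩ → x ≈ τ ⟨ j ⟩ → Root v q g → Root v x h → ¬ g ≉ h
  Root-unique {q} {x} {v} {g} {h} j 0<j q≈ x≈ root-g root-h g≉h =
    ∼0-multiples⇒≈0 {s = g - h} multiples (λ eq → g≉h (x-y≈0⇒x≈y g h eq))
    where
    multiples : ∀ m → 0 < m → (g - h) * τ ⟨ m ⟩ ∼ 0# × (g - h) * τ ⟨ m ⟩ * τ ∼ 0#
    multiples m 0<m =
      ∼-trans (∼-reflexive ([y-z]x≈yx-zx _ g h)) (∼⇒-∼0 (∼-trans (∼-sym (proj₁ G)) (proj₁ H))) ,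
      ∼-trans (∼-reflexive (trans (*-congʳ ([y-z]x≈yx-zx _ g h)) ([y-z]x≈yx-zx τ _ _)))
        (∼⇒-∼0 (∼-trans (∼-sym (proj₂ G)) (∼-trans (∼-reflexive (*-congˡ (trans q≈ (sym x≈)))) (proj₂ H))))
      where
      -- Both roots are tested on the same pair, so the sides containing `v` agree, and subtraction
      -- leaves multiples of `g - h` equivalent to 0.
      G = root-g (τ ⟨ m ⟩) (τ ⟨ j ℕ.+ m ⟩) (Sum-intro j m 0<j 0<m q≈ refl refl)
      H = root-h (τ ⟨ m ⟩) (τ ⟨ j ℕ.+ m ⟩) (Sum-intro j m 0<j 0<m x≈ refl refl)

  -- For y = τ ⟨ m ⟩ this says v = w ⟨ m ⟩: the chain of roots w ⟨ m ⟩, …, w ⟨ 1 ⟩, w of v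
  -- is certified one p-th power at a time.
  FrobeniusImage : Carrier → Carrier → Carrier → Set (c ⊔ ℓ)
  FrobeniusImage y w v = Root v y w × (∃[ g ] v ≈ g ^ p × Root v (τ ^ p) g) ×
    (∀ q → (∃[ e ] Sum q e y) → ∃[ g ] Root v q (g ^ p) × Root v (q ^ p) g)

  τ^p≈τ⟨1⟩ : τ ^ p ≈ τ ⟨ 1 ⟩
  τ^p≈τ⟨1⟩ = ^-congʳ τ (≡.sym (ℕ.*-identityʳ p))

  FrobeniusImage-intro : ∀ m → 0 < m → y ≈ τ ⟨ m ⟩ → v ≈ w ⟨ m ⟩ → FrobeniusImage y w v
  FrobeniusImage-intro {y} {v} {w} m@(ℕ.suc m′) _ y≈ v≈ =
    Root-intro m y≈ v≈ ,
    -- The p-th root of v is the first link of the chain, one Frobenius step below `w ⟨ m ⟩`.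
    (w ⟨ m′ ⟩ , v≈w⟨m′⟩^p , Root-intro 1 τ^p≈τ⟨1⟩ (trans v≈w⟨m′⟩^p (^-congʳ (w ⟨ m′ ⟩) (≡.sym (ℕ.*-identityʳ p))))) ,
    link
    where
    v≈w⟨m′⟩^p : v ≈ w ⟨ m′ ⟩ ^ p
    v≈w⟨m′⟩^p = trans v≈ (^-suc-p^ w m′)

    link : ∀ q → (∃[ e ] Sum q e y) → ∃[ g ] Root v q (g ^ p) × Root v (q ^ p) g
    link q (e , sum-qey) with Sum-elim sum-qey
    ... | _ , (ℕ.zero , record { nonZero = () }) , _
    ... | (j , _) , (i@(ℕ.suc i′) , _) , (n , _) , j+i≡n , q≈ , _ , y≈′ =
      -- Here m = j + i with i = 1 + i′: the link for exponent j is `w ⟨ i ⟩`, and the next one, for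
      -- j + 1, is its p-th root `w ⟨ i′ ⟩`.
      w ⟨ i′ ⟩ ,
      Root-intro j q≈ (trans v≈w⟨i+j⟩ (trans (⟨⟩-+ w i j) (⟨⟩-cong j (^-suc-p^ w i′)))) ,
      Root-intro (ℕ.suc j) (τ⟨⟩-suc j q≈)
        (trans v≈w⟨i+j⟩ (trans (^-congʳ w (≡.cong (p ℕ.^_) {x = i ℕ.+ j} (≡.sym (ℕ.+-suc i′ j)))) (⟨⟩-+ w i′ (ℕ.suc j))))
      where
      v≈w⟨i+j⟩ : v ≈ w ⟨ i ℕ.+ j ⟩
      v≈w⟨i+j⟩ = trans v≈ (^-congʳ w (≡.cong (p ℕ.^_)
        (≡.trans (τ⟨⟩-injective m n (trans (sym y≈) y≈′)) (≡.trans (≡.sym j+i≡n) (ℕ.+-comm j i)))))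

  -- Induction along the chain shows that every root g for an exponent j ≤ m satisfies v = gᵖ^ʲ,
  -- read as g raised to p ^ j. For j = 1 uniqueness identifies g with the true p-th root of v.
  -- Passing from j to j + 1, it identifies g with the element g′ given by `link`, and the induction
  -- hypothesis applies to the p-th power of g′.
  FrobeniusImage-elim : ∀ m → 0 < m → y ≈ τ ⟨ m ⟩ → FrobeniusImage y w v → ¬ v ≉ w ⟨ m ⟩
  FrobeniusImage-elim {y} {w} {v} m@(ℕ.suc m′) _ y≈ (root-w , (g₁ , v≈g₁^p , root-g₁) , link) =
    root⇒ m′ ℕ.≤-refl y≈ root-w
    where
    -- The index is shifted by one: `root⇒ j` concerns the exponent 1 + j, so the induction starts
    -- at exponent 1.
    root⇒ : ∀ j → ℕ.suc j ≤ m → ∀ {q g} → q ≈ τ ⟨ ℕ.suc j ⟩ → Root v q g → ¬ v ≉ g ⟨ ℕ.suc j ⟩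
    root⇒ ℕ.zero _ q≈ root-g v≉ = Root-unique 1 ℕ.z<s q≈ τ^p≈τ⟨1⟩ root-g root-g₁ λ g≈g₁ →
      v≉ (trans v≈g₁^p (trans (^-congˡ p (sym g≈g₁)) (^-congʳ _ (≡.sym (ℕ.*-identityʳ p)))))
    root⇒ (ℕ.suc j) j<m {q} {g} q≈ root-g v≉ =
      -- The premise of `link` needs a positive complement: `suc j` is completed to m by `suc o`,
      -- available because 2 + j ≤ m.
      let o , 2+j+o≡m = ℕ.m≤n⇒∃[o]m+o≡n j<m
          y≈′ = trans y≈ (^-congʳ τ (≡.cong (p ℕ.^_) (≡.trans (≡.sym 2+j+o≡m) (≡.sym (ℕ.+-suc (ℕ.suc j) o)))))
          g′ , root-g′^p , root-g′ = link (τ ⟨ ℕ.suc j ⟩)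
            (τ ⟨ ℕ.suc o ⟩ , Sum-intro (ℕ.suc j) (ℕ.suc o) ℕ.z<s ℕ.z<s refl refl y≈′)
      in Root-unique (ℕ.suc (ℕ.suc j)) ℕ.z<s q≈ (sym (^-suc-p^ τ (ℕ.suc j))) root-g root-g′ λ g≈g′ →
         root⇒ j (ℕ.<⇒≤ j<m) refl root-g′^p λ v≈ →
         v≉ (trans v≈ (trans (⟨⟩-cong (ℕ.suc j) (^-congˡ p (sym g≈g′))) (^-assocʳ g p (p ℕ.^ ℕ.suc j))))

  -- The witness for m ∣ n is w = τ ^ e with e = (pⁿ − 1) / (pᵐ − 1).
  Divides : Carrier → Carrier → Set (c ⊔ ℓ)
  Divides y z = ∃[ w ] ∃[ v ] w ≉ 0# × FrobeniusImage y w v × (w * z ≈ v * τ)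

  Divides-intro : ∀ m n → 0 < m → y ≈ τ ⟨ m ⟩ → z ≈ τ ⟨ n ⟩ → m ∣ n → Divides y z
  Divides-intro {y} {z} m n 0<m y≈ z≈ (divides r ≡.refl) with geometric m r
  -- The equation `w * z ≈ v * τ` is the division-free form of w^(pᵐ - 1) = τ^(pⁿ - 1); for w = τᵉ
  -- it reduces to the identity of exponents from `geometric`.
  ... | e , e+p^n≡ = τ ^ e , (τ ^ e) ⟨ m ⟩ , τ^n≉0 e , FrobeniusImage-intro m 0<m y≈ refl , (begin
    τ ^ e * z                        ≈⟨ *-congˡ z≈ ⟩
    τ ^ e * τ ⟨ r ℕ.* m ⟩            ≈⟨ ^-homo-* τ e (p ℕ.^ (r ℕ.* m)) ⟨
    τ ^ (e ℕ.+ p ℕ.^ (r ℕ.* m))      ≡⟨ ≡.cong (τ ^_) e+p^n≡ ⟩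
    τ ^ (p ℕ.^ m ℕ.* e ℕ.+ 1)        ≈⟨ ^-homo-* τ (p ℕ.^ m ℕ.* e) 1 ⟩
    τ ^ (p ℕ.^ m ℕ.* e) * τ ^ 1      ≈⟨ *-cong (^-congʳ τ (ℕ.*-comm (p ℕ.^ m) e)) (*-identityʳ τ) ⟩
    τ ^ (e ℕ.* p ℕ.^ m) * τ          ≈⟨ *-congʳ (^-assocʳ τ e (p ℕ.^ m)) ⟨
    (τ ^ e) ⟨ m ⟩ * τ                ∎)

  -- With v = w^(pᵐ), comparing orders at 𝔮, where ord τ = -1, gives (pᵐ - 1) · ord w = -(pⁿ - 1).
  Divides-elim : ∀ m n → 0 < m → y ≈ τ ⟨ m ⟩ → z ≈ τ ⟨ n ⟩ → Divides y z → m ∣ n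
  Divides-elim {y} {z} m n 0<m y≈ z≈ (w , v , w≉0 , frobenius , wz≈vτ) =
    decidable-stable (m ∣? n) λ m∤n → FrobeniusImage-elim m 0<m y≈ frobenius λ v≈w⟨m⟩ →
    m∤n (pred-p^-∣⇒∣ 0<m n (pred∣pred (trans (*-congˡ (sym z≈)) (trans wz≈vτ (*-congʳ v≈w⟨m⟩)))))
    where
    -- Here a and b stand for pⁿ - 1 and pᵐ - 1, and f for `ord w`; writing the powers as 1 + a and
    -- 1 + b avoids truncated subtraction.
    ℤ-identity : ∀ a b f → f ℤ.+ ℤ.- (1ℤ ℤ.+ a) ≡ (1ℤ ℤ.+ b) ℤ.* f ℤ.+ -1ℤ → ℤ.- a ≡ b ℤ.* f
    ℤ-identity a b f eq = ≡.trans (S.solve 2 (λ a f → S.:- a S.:= (f S.:+ S.:- (S.con 1ℤ S.:+ a)) S.:+ (S.con 1ℤ S.:- f)) ≡.refl a f)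
      (≡.trans (≡.cong (ℤ._+ (1ℤ ℤ.- f)) eq)
        (S.solve 2 (λ b f → ((S.con 1ℤ S.:+ b) S.:* f S.:+ S.con -1ℤ) S.:+ (S.con 1ℤ S.:- f) S.:= b S.:* f) ≡.refl b f))
      where module S = +-*-Solver

    abs-∣ : ∀ a b f → ℤ.- + a ≡ + b ℤ.* f → b ∣ a
    abs-∣ a b f eq = ≡.subst (b ∣_) (≡.sym (≡.trans (≡.sym (ℤ.∣-i∣≡∣i∣ (+ a)))
      (≡.trans (≡.cong ℤ.∣_∣ eq) (ℤ.abs-* (+ b) f)))) (m∣m*n ℤ.∣ f ∣)

    suc-pred-p^ : ∀ k → 1ℤ ℤ.+ + ℕ.pred (p ℕ.^ k) ≡ + (p ℕ.^ k)
    suc-pred-p^ k = ≡.cong +_ (ℕ.suc-pred (p ℕ.^ k) ⦃ ℕ.>-nonZero (ℕ.≤-<-trans ℕ.z≤n (n<p^n k)) ⦄)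

    pred∣pred : w * τ ⟨ n ⟩ ≈ w ⟨ m ⟩ * τ → ℕ.pred (p ℕ.^ m) ∣ ℕ.pred (p ℕ.^ n)
    pred∣pred eq = abs-∣ (ℕ.pred (p ℕ.^ n)) (ℕ.pred (p ℕ.^ m)) (ord w w≉0)
        (ℤ-identity (+ ℕ.pred (p ℕ.^ n)) (+ ℕ.pred (p ℕ.^ m)) (ord w w≉0) ord-equation)
      where
      w⟨m⟩≉0 = ^-≉0 w≉0 (p ℕ.^ m)
      lhs≉0 = *-≉0 w≉0 (τ^n≉0 (p ℕ.^ n))
      rhs≉0 = *-≉0 w⟨m⟩≉0 τ≉0

      ord-lhs : ord _ lhs≉0 ≡ ord w w≉0 ℤ.+ ℤ.- (1ℤ ℤ.+ + ℕ.pred (p ℕ.^ n))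
      ord-lhs = ≡.trans (ord-* w≉0 (τ^n≉0 (p ℕ.^ n)) lhs≉0) (≡.cong (ℤ._+_ (ord w w≉0))
        (≡.trans (ord-τ^ (p ℕ.^ n)) (≡.cong (ℤ.-_) (≡.sym (suc-pred-p^ n)))))

      ord-rhs : ord _ rhs≉0 ≡ (1ℤ ℤ.+ + ℕ.pred (p ℕ.^ m)) ℤ.* ord w w≉0 ℤ.+ -1ℤ
      ord-rhs = ≡.trans (ord-* w⟨m⟩≉0 τ≉0 rhs≉0) (≡.cong₂ ℤ._+_
        (≡.trans (ord-^ w≉0 (p ℕ.^ m) w⟨m⟩≉0) (≡.cong (ℤ._* ord w w≉0) (≡.sym (suc-pred-p^ m)))) ord-τ)

      ord-equation : ord w w≉0 ℤ.+ ℤ.- (1ℤ ℤ.+ + ℕ.pred (p ℕ.^ n)) ≡ (1ℤ ℤ.+ + ℕ.pred (p ℕ.^ m)) ℤ.* ord w w≉0 ℤ.+ -1ℤ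
      ord-equation = ≡.trans (≡.sym ord-lhs) (≡.trans (ord-cong lhs≉0 rhs≉0 eq) ord-rhs)

-- The model when t has a simple pole.

ℤ>0-≡ : {m n : ℤ>0} → proj₁ m ≡ proj₁ n → m ≡ n
ℤ>0-≡ {ℕ.suc _ , _} {ℕ.suc _ , _} ≡.refl = ≡.refl

module SimplePoleModel {c ℓ f} (K : CommutativeRing c ℓ)
  {F : Pred (CommutativeRing.Carrier K) f} (isField : IsField K) (isSubfield : IsSubfield K F) (𝔮 : Prime K F)
  {p} (p-prime : PrimeNumber p) (char : HasCharacteristic K p)
  {τ} (τ≉0 : CommutativeRing._≉_ K τ (CommutativeRing.0# K)) (ord-τ : Prime.ord 𝔮 τ τ≉0 ≡ -1ℤ)
  (P-definable : Definable K (pPowers K p τ)) where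

  open CommutativeRing K hiding (zero)
  open ArtinSchreier K p-prime char
  open FrobeniusPowers K isField isSubfield 𝔮 p-prime char τ≉0 ord-τ
  open DefinableOver K (τ ∷ proj₁ (proj₂ P-definable))

  private
    variable
      n : ℕ
      f′ g h : Vec Carrier n → Carrier

  τᵗ : TermDef {n} (λ _ → τ)
  τᵗ = paramᵗ zero

  -- `Def-reindex` substitutes only variables, so a term enters the given formula through a
  -- quantified variable equated with it.
  IsPPowerᵈ : TermDef f′ → Def (λ v → IsPPower (f′ v))
  IsPPowerᵈ s = Def-resp (λ v → mk⇔ (λ (x , x≈ , k , x≈′) → k , trans (sym x≈) x≈′) (λ P → _ , refl , P))
    (∃ᵈ ((varᵗ zero ≐ᵈ weakenᵗ s) ∧ᵈ Def-reindex (Definable⇒Def K P-definable τ) (zero ∷ [])))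

  infix 4 _∼ᵈ_
  _∼ᵈ_ : TermDef f′ → TermDef g → Def (λ v → f′ v ∼ g v)
  s ∼ᵈ t = ∃ᵈ (weakenᵗ s +ᵗ varᵗ zero ≐ᵈ weakenᵗ t +ᵗ varᵗ zero ^ᵗ p)

  Sumᵈ : TermDef f′ → TermDef g → TermDef h → Def (λ v → Sum (f′ v) (g v) (h v))
  Sumᵈ x y z = IsPPowerᵈ x ∧ᵈ IsPPowerᵈ y ∧ᵈ IsPPowerᵈ z ∧ᵈ
    (z *ᵗ y ∼ᵈ x *ᵗ τᵗ) ∧ᵈ (z ^ᵗ p *ᵗ y ∼ᵈ x ^ᵗ p *ᵗ τᵗ)

  Rootᵈ : TermDef f′ → TermDef g → TermDef h → Def (λ v → Root (f′ v) (g v) (h v))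
  Rootᵈ v q r = ∀ᵈ (∀ᵈ (Sumᵈ q″ u u′ ⇒ᵈ
    (v″ *ᵗ u′ ∼ᵈ r″ *ᵗ u) ∧ᵈ (v″ *ᵗ u′ *ᵗ q″ ∼ᵈ r″ *ᵗ u *ᵗ τᵗ)))
    where
    u  = varᵗ (suc zero)
    u′ = varᵗ zero
    v″ = weakenᵗ (weakenᵗ v)
    q″ = weakenᵗ (weakenᵗ q)
    r″ = weakenᵗ (weakenᵗ r)

  FrobeniusImageᵈ : TermDef f′ → TermDef g → TermDef h → Def (λ v → FrobeniusImage (f′ v) (g v) (h v))
  FrobeniusImageᵈ y w v = Rootᵈ v y w ∧ᵈ
    ∃ᵈ ((weakenᵗ v ≐ᵈ varᵗ zero ^ᵗ p) ∧ᵈ Rootᵈ (weakenᵗ v) (τᵗ ^ᵗ p) (varᵗ zero)) ∧ᵈ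
    ∀ᵈ (∃ᵈ (Sumᵈ (varᵗ (suc zero)) (varᵗ zero) (weakenᵗ (weakenᵗ y))) ⇒ᵈ
      ∃ᵈ (Rootᵈ (weakenᵗ (weakenᵗ v)) (varᵗ (suc zero)) (varᵗ zero ^ᵗ p) ∧ᵈ
          Rootᵈ (weakenᵗ (weakenᵗ v)) (varᵗ (suc zero) ^ᵗ p) (varᵗ zero)))

  Dividesᵈ : TermDef f′ → TermDef g → Def (λ v → Divides (f′ v) (g v))
  Dividesᵈ y z = ∃ᵈ (∃ᵈ ((¬ᵈ (w ≐ᵈ 0ᵗ)) ∧ᵈ FrobeniusImageᵈ (weakenᵗ (weakenᵗ y)) w v ∧ᵈ
    (w *ᵗ weakenᵗ (weakenᵗ z) ≐ᵈ v *ᵗ τᵗ)))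
    where
    w = varᵗ (suc zero)
    v = varᵗ zero

  additionGraph-definable : Definable K (AdditionGraph K (frobeniusPower K p τ))
  additionGraph-definable = Def⇒Definable (Def-resp Sum⇔AdditionGraph
    (Sumᵈ (varᵗ zero) (varᵗ (suc zero)) (varᵗ (suc (suc zero)))))
    where
    Sum⇔AdditionGraph : ∀ v → Sum (lookup v zero) (lookup v (suc zero)) (lookup v (suc (suc zero))) ⇔
      AdditionGraph K (frobeniusPower K p τ) v
    Sum⇔AdditionGraph (x ∷ y ∷ z ∷ []) = mk⇔
      (λ sum → let k , m , n , k+m≡n , x≈ , y≈ , z≈ = Sum-elim sum in
        k , m , n , k+m≡n , x≈ ∷ y≈ ∷ z≈ ∷ [])
      (λ { ((k , k≢0) , (m , m≢0) , n , ≡.refl , x≈ ∷ y≈ ∷ z≈ ∷ []) →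
        Sum-intro k m (ℕ.>-nonZero⁻¹ k ⦃ k≢0 ⦄) (ℕ.>-nonZero⁻¹ m ⦃ m≢0 ⦄) x≈ y≈ z≈ })

  divisibilityGraph-definable : Definable K (DivisibilityGraph K (frobeniusPower K p τ))
  divisibilityGraph-definable = Def⇒Definable (Def-resp Divides⇔DivisibilityGraph
    -- `Divides` expresses divisibility only between p-powers of τ, so membership is required
    -- separately; `Sum` contains it already.
    (IsPPowerᵈ (varᵗ zero) ∧ᵈ IsPPowerᵈ (varᵗ (suc zero)) ∧ᵈ Dividesᵈ (varᵗ zero) (varᵗ (suc zero))))
    where
    Divides⇔DivisibilityGraph : ∀ v →
      (IsPPower (lookup v zero) × IsPPower (lookup v (suc zero)) × Divides (lookup v zero) (lookup v (suc zero))) ⇔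
      DivisibilityGraph K (frobeniusPower K p τ) v
    Divides⇔DivisibilityGraph (y ∷ z ∷ []) = mk⇔
      (λ { ((m , y≈) , (n , z≈) , y∣z) →
        m , n , Divides-elim (proj₁ m) (proj₁ n) (ℕ.>-nonZero⁻¹ _ ⦃ proj₂ m ⦄) y≈ z≈ y∣z , y≈ ∷ z≈ ∷ [] })
      (λ { (m , n , m∣n , y≈ ∷ z≈ ∷ []) →
        (m , y≈) , (n , z≈) , Divides-intro (proj₁ m) (proj₁ n) (ℕ.>-nonZero⁻¹ _ ⦃ proj₂ m ⦄) y≈ z≈ m∣n })

  isModel : IsModel K (pPowers K p τ) (frobeniusPower K p τ)
  isModel = record
    { D-definable = P-definable
    ; into        = λ n → n , refl
    ; injective   = λ { {m} {n} (eq ∷ []) → ℤ>0-≡ (τ⟨⟩-injective (proj₁ m) (proj₁ n) eq) }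
    ; onto        = λ { {_ ∷ []} (n , x≈) → n , x≈ ∷ [] }
    ; +-definable = additionGraph-definable
    ; ∣-definable = divisibilityGraph-definable
    }

-- Transfer of the model from τ to its inverse.

module InverseTransfer {c ℓ} (K : CommutativeRing c ℓ) (p : ℕ) where
  open CommutativeRing K hiding (zero)
  open SExp semiring using (_^_; ^-congˡ)
  open CSExp commutativeSemiring using (^-distrib-*)
  open SetoidReasoning setoid

  1^n≈1 : ∀ n → 1# ^ n ≈ 1#
  1^n≈1 ℕ.zero    = refl
  1^n≈1 (ℕ.suc n) = trans (*-identityˡ _) (1^n≈1 n)

  *-inverse-^ : ∀ {t τ x} → t * τ ≈ 1# → ∀ n → x ≈ t ^ n → x * τ ^ n ≈ 1#
  *-inverse-^ {t} {τ} tτ≈1 n x≈tⁿ = trans (*-congʳ x≈tⁿ) (trans (sym (^-distrib-* t τ n)) (trans (^-congˡ n tτ≈1) (1^n≈1 n)))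

  inverse-≈^ : ∀ {t τ x y} → t * τ ≈ 1# → x * y ≈ 1# → ∀ n → y ≈ τ ^ n → x ≈ t ^ n
  inverse-≈^ {t} {τ} {x} {y} tτ≈1 xy≈1 n y≈τⁿ = begin
    x                      ≈⟨ *-identityʳ x ⟨
    x * 1#                 ≈⟨ *-congˡ (trans (*-comm _ _) (*-inverse-^ tτ≈1 n refl)) ⟨
    x * (τ ^ n * t ^ n)    ≈⟨ *-assoc x _ _ ⟨
    x * τ ^ n * t ^ n      ≈⟨ *-congʳ (trans (*-congˡ (sym y≈τⁿ)) xy≈1) ⟩
    1# * t ^ n             ≈⟨ *-identityˡ _ ⟩
    t ^ n                  ∎

  -- Inversion is definable by `x * y ≈ 1#` and exchanges the powers of `t` and `τ`, so one set is
  -- defined by quantifying over inverses in the other. The two graphs are treated coordinatewise in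
  -- the same way.
  pPowers-inverse : ∀ {t τ} → t * τ ≈ 1# → Definable K (pPowers K p τ) → Definable K (pPowers K p t)
  pPowers-inverse {t} {τ} tτ≈1 (_ , params , φ , φ⇔) = Def⇒Definable (Def-resp correct
    (∃ᵈ ((varᵗ (suc zero) *ᵗ varᵗ zero ≐ᵈ 1ᵗ) ∧ᵈ Def-reindex (mkDef φ φ⇔) (zero ∷ []))))
    where
    open DefinableOver K params
    correct : ∀ v → (∃[ y ] lookup v zero * y ≈ 1# × pPowers K p τ (y ∷ [])) ⇔ pPowers K p t v
    correct (x ∷ []) = mk⇔
      (λ (y , xy≈1 , n , y≈) → n , inverse-≈^ tτ≈1 xy≈1 (p ℕ.^ proj₁ n) y≈)
      (λ (n , x≈) → _ , *-inverse-^ tτ≈1 (p ℕ.^ proj₁ n) x≈ , n , refl)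

  additionGraph-inverse : ∀ {t τ} → t * τ ≈ 1# →
    Definable K (AdditionGraph K (frobeniusPower K p τ)) → Definable K (AdditionGraph K (frobeniusPower K p t))
  additionGraph-inverse {t} {τ} tτ≈1 (_ , params , φ , φ⇔) = Def⇒Definable (Def-resp correct
    (∃ᵈ (∃ᵈ (∃ᵈ ((varᵗ (suc (suc (suc zero))) *ᵗ varᵗ (suc (suc zero)) ≐ᵈ 1ᵗ) ∧ᵈ
      (varᵗ (suc (suc (suc (suc zero)))) *ᵗ varᵗ (suc zero) ≐ᵈ 1ᵗ) ∧ᵈ
      (varᵗ (suc (suc (suc (suc (suc zero))))) *ᵗ varᵗ zero ≐ᵈ 1ᵗ) ∧ᵈ
      Def-reindex (mkDef φ φ⇔) (suc (suc zero) ∷ suc zero ∷ zero ∷ []))))))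
    where
    open DefinableOver K params
    correct : ∀ v → (∃[ x ] ∃[ y ] ∃[ z ] lookup v zero * x ≈ 1# × lookup v (suc zero) * y ≈ 1# ×
      lookup v (suc (suc zero)) * z ≈ 1# × AdditionGraph K (frobeniusPower K p τ) (x ∷ y ∷ z ∷ [])) ⇔
      AdditionGraph K (frobeniusPower K p t) v
    correct (_ ∷ _ ∷ _ ∷ []) = mk⇔
      (λ { (_ , _ , _ , xx′≈1 , yy′≈1 , zz′≈1 , k , m , n , k+m≡n , x≈ ∷ y≈ ∷ z≈ ∷ []) →
        k , m , n , k+m≡n ,
        inverse-≈^ tτ≈1 xx′≈1 (p ℕ.^ proj₁ k) x≈ ∷ inverse-≈^ tτ≈1 yy′≈1 (p ℕ.^ proj₁ m) y≈ ∷ inverse-≈^ tτ≈1 zz′≈1 (p ℕ.^ proj₁ n) z≈ ∷ [] })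
      (λ { (k , m , n , k+m≡n , x≈ ∷ y≈ ∷ z≈ ∷ []) → _ , _ , _ ,
        *-inverse-^ tτ≈1 (p ℕ.^ proj₁ k) x≈ , *-inverse-^ tτ≈1 (p ℕ.^ proj₁ m) y≈ ,
        *-inverse-^ tτ≈1 (p ℕ.^ proj₁ n) z≈ , k , m , n , k+m≡n , refl ∷ refl ∷ refl ∷ [] })

  divisibilityGraph-inverse : ∀ {t τ} → t * τ ≈ 1# →
    Definable K (DivisibilityGraph K (frobeniusPower K p τ)) → Definable K (DivisibilityGraph K (frobeniusPower K p t))
  divisibilityGraph-inverse {t} {τ} tτ≈1 (_ , params , φ , φ⇔) = Def⇒Definable (Def-resp correct
    (∃ᵈ (∃ᵈ ((varᵗ (suc (suc zero)) *ᵗ varᵗ (suc zero) ≐ᵈ 1ᵗ) ∧ᵈ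
      (varᵗ (suc (suc (suc zero))) *ᵗ varᵗ zero ≐ᵈ 1ᵗ) ∧ᵈ
      Def-reindex (mkDef φ φ⇔) (suc zero ∷ zero ∷ [])))))
    where
    open DefinableOver K params
    correct : ∀ v → (∃[ x ] ∃[ y ] lookup v zero * x ≈ 1# × lookup v (suc zero) * y ≈ 1# ×
      DivisibilityGraph K (frobeniusPower K p τ) (x ∷ y ∷ [])) ⇔ DivisibilityGraph K (frobeniusPower K p t) v
    correct (_ ∷ _ ∷ []) = mk⇔
      (λ { (_ , _ , xx′≈1 , yy′≈1 , m , n , m∣n , x≈ ∷ y≈ ∷ []) →
        m , n , m∣n , inverse-≈^ tτ≈1 xx′≈1 (p ℕ.^ proj₁ m) x≈ ∷ inverse-≈^ tτ≈1 yy′≈1 (p ℕ.^ proj₁ n) y≈ ∷ [] })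
      (λ { (m , n , m∣n , x≈ ∷ y≈ ∷ []) → _ , _ ,
        *-inverse-^ tτ≈1 (p ℕ.^ proj₁ m) x≈ , *-inverse-^ tτ≈1 (p ℕ.^ proj₁ n) y≈ ,
        m , n , m∣n , refl ∷ refl ∷ [] })

  isModel-inverse : ∀ {t τ} → t * τ ≈ 1# →
    IsModel K (pPowers K p τ) (frobeniusPower K p τ) → IsModel K (pPowers K p t) (frobeniusPower K p t)
  isModel-inverse {t} {τ} tτ≈1 model = record
    { D-definable = pPowers-inverse tτ≈1 D-definable
    ; into        = λ n → n , refl
    -- Equal powers of `t` have equal inverses, which are powers of `τ`, where injectivity is known.
    ; injective   = λ { {m} {n} (eq ∷ []) → injective
        (inverse-≈^ τt≈1 (*-inverse-^ τt≈1 (p ℕ.^ proj₁ m) refl) (p ℕ.^ proj₁ n) eq ∷ []) }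
    ; onto        = λ { {_ ∷ []} (n , x≈) → n , x≈ ∷ [] }
    ; +-definable = additionGraph-inverse tτ≈1 +-definable
    ; ∣-definable = divisibilityGraph-inverse tτ≈1 ∣-definable
    }
    where
    open IsModel model
    τt≈1 = trans (*-comm τ t) tτ≈1

-- Assembly of the result.

IsModel⇒HasModel : ∀ {c ℓ} (K : CommutativeRing c ℓ) {p t} →
  IsModel K (pPowers K p t) (frobeniusPower K p t) → HasModel K
-- The domain is lifted because `HasModel` takes predicates at level `c ⊔ ℓ`, whereas `pPowers`
-- lives at level `ℓ`.
IsModel⇒HasModel {c} K {p} {t} model = 1 , _ , (λ v → Lift c (pPowers K p t v)) , frobeniusPower K p t , record
  { D-definable = let m , params , φ , φ⇔ = D-definable in
      m , params , φ , λ v → mk⇔ (λ v∈D → to (φ⇔ v) (lower v∈D)) (λ sat → lift (from (φ⇔ v) sat))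
  ; into        = λ n → lift (into n)
  ; injective   = injective
  ; onto        = λ v∈D → onto (lower v∈D)
  ; +-definable = +-definable
  ; ∣-definable = ∣-definable
  }
  where open IsModel model

theorem2p7 : {c ℓ f : Level} (K : CommutativeRing c ℓ) (F : Pred (CommutativeRing.Carrier K) f) →
    IsFunctionField K F → AlgebraicallyClosedIn K F →
    (p : ℕ) → 0 < p → HasCharacteristic K p →
    (t : CommutativeRing.Carrier K) → ¬ F t → ¬ IsPower K p t →
    HasSimpleZeroOrPole K F t →
    Definable K (pPowers K p t) →
    HasModel K × IsModel K (pPowers K p t) (frobeniusPower K p t)
theorem2p7 K F functionField _ p 0<p char t _ _ (𝔮 , t≉0 , ord-t) P-definable =
  IsModel⇒HasModel K model , model
  where
  open CommutativeRing K using (1#; _*_; _≈_; 0#; _≉_; trans; *-comm)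
  open IsFunctionField functionField using (isField; isSubfield)
  open FieldProperties K isField
  open Prime 𝔮
  p-prime = characteristic-prime 0<p char

  simpleZero : ord t t≉0 ≡ 1ℤ → IsModel K (pPowers K p t) (frobeniusPower K p t)
  simpleZero ord-t≡1 with inverse t t≉0
  -- Definability is carried from `t` to its inverse `τ`, which has a simple pole at 𝔮, and the
  -- model obtained there is carried back to `t`.
  ... | τ , tτ≈1 = InverseTransfer.isModel-inverse K p tτ≈1
    (SimplePoleModel.isModel K isField isSubfield 𝔮 p-prime char τ≉0 ord-τ
      (InverseTransfer.pPowers-inverse K p τt≈1 P-definable))
    where
    τt≈1 = trans (*-comm τ t) tτ≈1
    τ≉0 = inverse-≉0 τt≈1
    tτ≉0 = *-≉0 t≉0 τ≉0

    1+ord-τ≡0 : 1ℤ ℤ.+ ord τ τ≉0 ≡ 0ℤ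
    1+ord-τ≡0 = ≡.trans (≡.cong (ℤ._+ ord τ τ≉0) (≡.sym ord-t≡1)) (≡.trans (≡.sym (ord-* t≉0 τ≉0 tτ≉0))
      (≡.trans (ord-cong tτ≉0 1≉0 tτ≈1) (constant 1≉0 (IsSubfield.1-closed isSubfield))))

    ord-τ : ord τ τ≉0 ≡ -1ℤ
    ord-τ = GroupProperties.inverseʳ-unique (AbelianGroup.group ℤ.+-0-abelianGroup) 1ℤ (ord τ τ≉0) 1+ord-τ≡0

  model : IsModel K (pPowers K p t) (frobeniusPower K p t)
  model = [ simpleZero , (λ ord-t≡-1 →
    SimplePoleModel.isModel K isField isSubfield 𝔮 p-prime char t≉0 ord-t≡-1 P-definable) ]′ ord-t
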